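{- For all $m>n\ge1$, the cost-SR calculus has a proof of $\mathrm{cost}(\mathrm{BPHP}^m_n)=m-n$ of size polynomial in $m$ and $n$.
   Context: $\mathrm{BPHP}^m_n$ is the CNF with variables $p_{i,j}$ ($i\in[m]$, $j\in[n]$) and blocking variables $b_i$ ($i\in[m]$) and $b_{i,k,j}$ ($1\le i<k\le m$, $j\in[n]$), consisting of the clauses $\bigvee_{j\in[n]}p_{i,j}\lor b_i$ for $i\in[m]$ and $\lnot p_{i,j}\lor\lnot p_{k,j}\lor b_{i,k,j}$ for $1\le i<k\le m$, $j\in[n]$. Notation: a substitution maps variables to $0$, $1$ or literals (with $\sigma(\lnot x)=\lnot\sigma(x)$); $(\sigma\circ\tau)(x)=\sigma(\tau(x))$; total assignments assign Boolean values to all variables. $C{\upharpoonright}_\sigma$: apply $\sigma$ to the literals and simplify; $\Gamma{\upharpoonright}_\sigma$ is the multiset of $C{\upharpoonright}_\sigma\ne1$, $C\in\Gamma$. $\lnot C$ is the partial assignment falsifying all literals of $C$. $\Gamma\vdash_1 C$ means unit propagation on $\Gamma{\upharpoonright}_{\lnot C}$ derives the empty clause; $\Gamma\vdash_1\Delta$ means this for all $D\in\Delta$. $\mathrm{cost}(\alpha)$ is the number of blocking variables set to $1$ by a total assignment $\alpha$; $\mathrm{cost}(\Gamma)=\min\{\mathrm{cost}(\alpha):\alpha\models\Gamma\}$. $C$ is cost-SR w.r.t. $\Gamma$ if there is a substitution $\sigma$ with (1) $\Gamma{\upharpoonright}_{\lnot C}\vdash_1(\Gamma\cup\{C\}){\upharpoonright}_\sigma$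 and (2) $\mathrm{cost}(\tau\circ\sigma)\le\mathrm{cost}(\tau)$ for all total $\tau\supseteq\lnot C$. A cost-SR calculus derivation from $\Gamma$: sequence $D_1,\dots,D_t$, each in $\Gamma$, or by weakening/resolution from earlier clauses, or cost-SR w.r.t. $\Gamma\cup\{D_1,\dots,D_{i-1}\}$ with $\mathrm{Var}(D_i)\subseteq\mathrm{Var}(\Gamma)$; its size is $t$. A proof of $\mathrm{cost}(\Gamma)=k$ is a derivation containing $k$ unit clauses $b$ for $k$ distinct blocking variables and the unit clauses $\lnot b'$ for all other blocking variables $b'$. -}

module Defs where

open import Data.Bool using (Bool; true; false; not; if_then_else_)
import Data.Bool.Properties as Bool
open import Data.Empty using (⊥-elim)
open import Data.Fin as Fin using (Fin)
import Data.Fin.Properties as Fin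
open import Data.List using (List; []; _∷_; _++_; map; mapMaybe; filter; length; allFin; cartesianProduct)
open import Data.List.Membership.Propositional using (_∈_; _∉_)
open import Data.List.Membership.Propositional.Properties
  using (∈-map⁺; ∈-map⁻; ∈-++⁺ˡ; ∈-++⁺ʳ; ∈-++⁻; ∈-allFin; ∈-cartesianProduct⁺)
open import Data.List.Relation.Binary.BagAndSetEquality using (_∼[_]_; set)
open import Data.List.Relation.Binary.Subset.Propositional using (_⊆_)
open import Data.List.Relation.Unary.All using (All; []; _∷_)
open import Data.List.Relation.Unary.AllPairs using ([]; _∷_)
open import Data.List.Relation.Unary.Any using (Any; here; there; any?)
open import Data.List.Relation.Unary.Unique.Propositional using (Unique)
import Data.List.Relation.Unary.Unique.Propositional.Properties as Unique
open import Data.Maybe using (Maybe; just; nothing)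
import Data.Maybe as Maybe
open import Data.Nat using (ℕ; _*_; _^_; _≤_)
open import Data.Nat.ListAction using (sum)
open import Data.Product using (Σ; ∃; _×_; _,_; proj₁; proj₂)
open import Data.Sum using (inj₁; inj₂)
open import Function using (_∘_)
open import Relation.Binary.Definitions using (DecidableEquality)
open import Relation.Binary.PropositionalEquality using (_≡_; refl; cong; subst; _≢_)
open import Relation.Nullary using (¬_; Dec; yes; no; does)
open import Relation.Nullary.Decidable using (_⊎-dec_; map′; dec⇒maybe)

------------------------------------------------------------------------
-- Two-variable polynomials over ℕ: the monomial (c , a , b) is c·xᵃ·yᵇ.

Polynomial : Set
Polynomial = List (ℕ × ℕ × ℕ)

⟦_⟧ : Polynomial → ℕ → ℕ → ℕ
⟦ q ⟧ x y = sum (map (λ (c , a , b) → c * x ^ a * y ^ b) q)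

------------------------------------------------------------------------
-- The cost-SR calculus

record Variables : Set₁ where
  field
    Var             : Set
    _≟ᵛ_            : DecidableEquality Var
    blocking        : List Var
    blocking-unique : Unique blocking

module CostSR (V : Variables) where
  open Variables V

  data Literal : Set where
    pos neg : Var → Literal

  negate : Literal → Literal
  negate (pos x) = neg x
  negate (neg x) = pos x

  var : Literal → Var
  var (pos x) = x
  var (neg x) = x

  pos-injective : ∀ {x y} → pos x ≡ pos y → x ≡ y
  pos-injective refl = refl

  neg-injective : ∀ {x y} → neg x ≡ neg y → x ≡ y
  neg-injective refl = refl

  _≟ˡ_ : DecidableEquality Literal
  pos x ≟ˡ pos y = map′ (cong pos) pos-injective (x ≟ᵛ y)
  pos x ≟ˡ neg y = no λ ()
  neg x ≟ˡ pos y = no λ ()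
  neg x ≟ˡ neg y = map′ (cong neg) neg-injective (x ≟ᵛ y)

  open import Data.List.Membership.DecPropositional _≟ˡ_ using (_∈?_)

  -- A clause is a set of literals: lists are always compared by _≈_.
  Clause : Set
  Clause = List Literal

  infix 4 _≈_ _∈ᶜ_
  infixl 7 _↾_ _↾ᶜ_

  _≈_ : Clause → Clause → Set
  C ≈ D = C ∼[ set ] D

  CNF : Set
  CNF = List Clause

  _∈ᶜ_ : Clause → CNF → Set
  C ∈ᶜ Γ = Any (C ≈_) Γ

  _occursIn_ : Var → CNF → Set
  x occursIn Γ = Any (Any (λ ℓ → x ≡ var ℓ)) Γ

  Tautological : Clause → Set
  Tautological C = Any (λ ℓ → negate ℓ ∈ C) C

  tautological? : (C : Clause) → Dec (Tautological C)
  tautological? C = any? (λ ℓ → negate ℓ ∈? C) C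

  -- The possible images of a literal under a substitution.
  data Value : Set where
    const : Bool → Value
    lit   : Literal → Value

  ¬ᵛ_ : Value → Value
  ¬ᵛ const b = const (not b)
  ¬ᵛ lit ℓ   = lit (negate ℓ)

  -- Partial assignments are the substitutions sending each variable to a
  -- constant or to itself.
  Substitution : Set
  Substitution = Var → Value

  apply : Substitution → Literal → Value
  apply σ (pos x) = σ x
  apply σ (neg x) = ¬ᵛ σ x

  data IsTrue : Value → Set where
    isTrue : IsTrue (const true)

  isTrue? : (v : Value) → Dec (IsTrue v)
  isTrue? (const true)  = yes isTrue
  isTrue? (const false) = no λ ()
  isTrue? (lit _)       = no λ ()

  getLiteral : Value → Maybe Literal
  getLiteral (const _) = nothing
  getLiteral (lit ℓ)   = just ℓ

  -- `nothing` is the constant 1.  Simplification uses D ∨ 0 = D, D ∨ 1 = 1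
  -- and D ∨ x ∨ ¬x = 1.
  _↾ᶜ_ : Clause → Substitution → Maybe Clause
  C ↾ᶜ σ =
    let vs = map (apply σ) C
        D  = mapMaybe getLiteral vs
    in if does (any? isTrue? vs ⊎-dec tautological? D) then nothing else just D

  _↾_ : CNF → Substitution → CNF
  Γ ↾ σ = mapMaybe (_↾ᶜ σ) Γ

  -- The partial assignment ¬C; meaningful when C is not tautological.
  falsify : Clause → Substitution
  falsify C x =
    if does (pos x ∈? C) then const false
    else if does (neg x ∈? C) then const true
    else lit (pos x)

  -- Unit propagation derives the empty clause.
  data UnitRefutable (Γ : CNF) : Set where
    conflict  : [] ∈ᶜ Γ → UnitRefutable Γ
    -- ℓ is set to 1, i.e. its negation is falsified
    propagate : ∀ ℓ → (ℓ ∷ []) ∈ᶜ Γ →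
                UnitRefutable (Γ ↾ falsify (negate ℓ ∷ [])) → UnitRefutable Γ

  _⊢₁_ : CNF → Clause → Set
  Γ ⊢₁ C = UnitRefutable (Γ ↾ falsify C)

  Assignment : Set
  Assignment = Var → Bool

  _⊇_ : Assignment → Substitution → Set
  τ ⊇ ρ = ∀ x b → ρ x ≡ const b → τ x ≡ b

  evalLiteral : Assignment → Literal → Bool
  evalLiteral τ (pos x) = τ x
  evalLiteral τ (neg x) = not (τ x)

  eval : Assignment → Value → Bool
  eval τ (const b) = b
  eval τ (lit ℓ)   = evalLiteral τ ℓ

  _∘ˢ_ : Assignment → Substitution → Assignment
  (τ ∘ˢ σ) x = eval τ (σ x)

  cost : Assignment → ℕ
  cost τ = length (filter (λ x → τ x Bool.≟ true) blocking)

  record IsCostSR (Γ : CNF) (C : Clause) : Set where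
    field
      nonTautological : ¬ Tautological C
      σ               : Substitution
      implied         : All (λ D → (Γ ↾ falsify C) ⊢₁ D) ((C ∷ Γ) ↾ σ)
      cost-≤          : ∀ τ → τ ⊇ falsify C → cost (τ ∘ˢ σ) ≤ cost τ

  -- Ds lists the preceding lines of the derivation.
  data Step (Γ : CNF) (Ds : List Clause) (D : Clause) : Set where
    axiom      : D ∈ᶜ Γ → Step Γ Ds D
    weakening  : ∀ C → C ∈ Ds → C ⊆ D → Step Γ Ds D
    resolution : ∀ x A B → (pos x ∷ A) ∈ᶜ Ds → (neg x ∷ B) ∈ᶜ Ds →
                 D ≈ A ++ B → Step Γ Ds D
    costSR     : IsCostSR (Ds ++ Γ) D →
                 All (λ ℓ → var ℓ occursIn Γ) D → Step Γ Ds D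

  -- Lines are listed in reverse order: the head is the last line derived.
  data Derivation (Γ : CNF) : List Clause → Set where
    []  : Derivation Γ []
    _∷_ : ∀ {D Ds} → Step Γ Ds D → Derivation Γ Ds → Derivation Γ (D ∷ Ds)

  -- Ds is a proof of cost(Γ) = k, of size `length Ds`.
  record IsCostProof (Γ : CNF) (k : ℕ) (Ds : List Clause) : Set where
    field
      derivation : Derivation Γ Ds
      ones       : List Var
      unique     : Unique ones
      count      : length ones ≡ k
      areBlock   : ones ⊆ blocking
      positive   : ∀ b → b ∈ ones → (pos b ∷ []) ∈ᶜ Ds
      negative   : ∀ b → b ∈ blocking → b ∉ ones → (neg b ∷ []) ∈ᶜ Ds

------------------------------------------------------------------------
-- The blocked pigeonhole principle, m pigeons and n holes

module _ (m n : ℕ) where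

  data PHPVar : Set where
    p  : Fin m → Fin n → PHPVar
    b₁ : Fin m → PHPVar
    b₂ : (i k : Fin m) → .(i Fin.< k) → Fin n → PHPVar

OrderedPair : ℕ → Set
OrderedPair m = Σ (Fin m × Fin m) λ (i , k) → i Fin.< k

orderedPair : ∀ {m} → Fin m × Fin m → Maybe (OrderedPair m)
orderedPair (i , k) = Maybe.map ((i , k) ,_) (dec⇒maybe (i Fin.<? k))

orderedPairs : ∀ m → List (OrderedPair m)
orderedPairs m = mapMaybe orderedPair (cartesianProduct (allFin m) (allFin m))

module _ {m n : ℕ} where

  b₂′ : OrderedPair m × Fin n → PHPVar m n
  b₂′ (((i , k) , i<k) , j) = b₂ i k i<k j

  _≟ᵇ_ : DecidableEquality (PHPVar m n)
  p i j ≟ᵇ p i′ j′ with i Fin.≟ i′ | j Fin.≟ j′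
  ... | yes refl | yes refl = yes refl
  ... | no i≢    | _        = no λ { refl → i≢ refl }
  ... | yes _    | no j≢    = no λ { refl → j≢ refl }
  p _ _ ≟ᵇ b₁ _ = no λ ()
  p _ _ ≟ᵇ b₂ _ _ _ _ = no λ ()
  b₁ _ ≟ᵇ p _ _ = no λ ()
  b₁ i ≟ᵇ b₁ i′ with i Fin.≟ i′
  ... | yes refl = yes refl
  ... | no i≢    = no λ { refl → i≢ refl }
  b₁ _ ≟ᵇ b₂ _ _ _ _ = no λ ()
  b₂ _ _ _ _ ≟ᵇ p _ _ = no λ ()
  b₂ _ _ _ _ ≟ᵇ b₁ _ = no λ ()
  b₂ i k _ j ≟ᵇ b₂ i′ k′ _ j′ with i Fin.≟ i′ | k Fin.≟ k′ | j Fin.≟ j′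
  ... | yes refl | yes refl | yes refl = yes refl
  ... | no i≢    | _        | _        = no λ { refl → i≢ refl }
  ... | yes _    | no k≢    | _        = no λ { refl → k≢ refl }
  ... | yes _    | yes _    | no j≢    = no λ { refl → j≢ refl }

phpBlocking : ∀ m n → List (PHPVar m n)
phpBlocking m n = map b₁ (allFin m) ++ map b₂′ (cartesianProduct (orderedPairs m) (allFin n))

orderedPair-sound : ∀ {m} (ik : Fin m × Fin m) {q} → orderedPair ik ≡ just q → proj₁ q ≡ ik
orderedPair-sound (i , k) eq with i Fin.<? k
orderedPair-sound (i , k) refl | yes _ = refl

module _ {m : ℕ} where

  private
    ∈-orderedPairs⁻ : ∀ xs {q : OrderedPair m} → q ∈ mapMaybe orderedPair xs → proj₁ q ∈ xs
    ∈-orderedPairs⁻ (x ∷ xs) q∈ with orderedPair x in eq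
    ∈-orderedPairs⁻ (x ∷ xs) q∈           | nothing = there (∈-orderedPairs⁻ xs q∈)
    ∈-orderedPairs⁻ (x ∷ xs) (here refl)  | just _  = here (orderedPair-sound x eq)
    ∈-orderedPairs⁻ (x ∷ xs) (there q∈)   | just _  = there (∈-orderedPairs⁻ xs q∈)

    ∈-orderedPairs⁺ : ∀ xs {i k : Fin m} → (i , k) ∈ xs → i Fin.< k →
                      ∃ λ i<k → ((i , k) , i<k) ∈ mapMaybe orderedPair xs
    ∈-orderedPairs⁺ (_ ∷ xs) {i} {k} (here refl) lt with i Fin.<? k
    ... | yes i<k = i<k , here refl
    ... | no  i≮k = ⊥-elim (i≮k lt)
    ∈-orderedPairs⁺ (x ∷ xs) (there q) lt with orderedPair x | ∈-orderedPairs⁺ xs q lt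
    ... | nothing | i<k , q∈ = i<k , q∈
    ... | just _  | i<k , q∈ = i<k , there q∈

    ∉⇒All≢ : ∀ {A : Set} {x : A} ys → x ∉ ys → All (x ≢_) ys
    ∉⇒All≢ []       _ = []
    ∉⇒All≢ (_ ∷ ys) h = (λ eq → h (here eq)) ∷ ∉⇒All≢ ys (h ∘ there)

    unique′ : ∀ {xs} → Unique xs → Unique (mapMaybe (orderedPair {m}) xs)
    unique′ [] = []
    unique′ {x ∷ xs} u@(_ ∷ us) with orderedPair x in eq
    ... | nothing = unique′ us
    ... | just q  = ∉⇒All≢ _ (λ q∈ → Unique.Unique[x∷xs]⇒x∉xs u
                      (subst (_∈ xs) (orderedPair-sound x eq) (∈-orderedPairs⁻ xs q∈)))
                    ∷ unique′ us

  orderedPairs-unique : Unique (orderedPairs m)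
  orderedPairs-unique = unique′ (Unique.cartesianProduct⁺ (Unique.allFin⁺ m) (Unique.allFin⁺ m))

  ∈-orderedPairs : ∀ {i k} → i Fin.< k → ∃ λ i<k → ((i , k) , i<k) ∈ orderedPairs m
  ∈-orderedPairs {i} {k} = ∈-orderedPairs⁺ _ (∈-cartesianProduct⁺ (∈-allFin i) (∈-allFin k))

module _ {m n : ℕ} where

  b₁-injective : ∀ {i i′} → b₁ {m} {n} i ≡ b₁ i′ → i ≡ i′
  b₁-injective refl = refl

  b₂′-injective : ∀ {x y} → b₂′ {m} {n} x ≡ b₂′ y → x ≡ y
  b₂′-injective {((i , k) , lt) , j} {((i′ , k′) , lt′) , j′} eq
    with b₂-injective eq
    where
    b₂-injective : ∀ {i i′ k k′ : Fin m} {j j′ : Fin n} .{lt lt′} →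
                   b₂ i k lt j ≡ b₂ i′ k′ lt′ j′ → i ≡ i′ × k ≡ k′ × j ≡ j′
    b₂-injective refl = refl , refl , refl
  ... | refl , refl , refl = cong (λ l → ((i , k) , l) , j) (Fin.<-irrelevant lt lt′)

  phpBlocking-unique : Unique (phpBlocking m n)
  phpBlocking-unique = Unique.++⁺
    (Unique.map⁺ b₁-injective (Unique.allFin⁺ m))
    (Unique.map⁺ b₂′-injective (Unique.cartesianProduct⁺ orderedPairs-unique (Unique.allFin⁺ n)))
    disjoint
    where
    disjoint : ∀ {v} → ¬ (v ∈ map b₁ (allFin m) ×
                          v ∈ map b₂′ (cartesianProduct (orderedPairs m) (allFin n)))
    disjoint (v∈₁ , v∈₂) with ∈-map⁻ b₁ v∈₁ | ∈-map⁻ b₂′ v∈₂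
    ... | _ , _ , refl | _ , _ , ()

  b₁∈phpBlocking : ∀ i → b₁ i ∈ phpBlocking m n
  b₁∈phpBlocking i = ∈-++⁺ˡ (∈-map⁺ b₁ (∈-allFin i))

  b₂∈phpBlocking : ∀ {i k} (i<k : i Fin.< k) j → b₂ i k i<k j ∈ phpBlocking m n
  b₂∈phpBlocking i<k j = ∈-++⁺ʳ (map b₁ (allFin m))
    (∈-map⁺ b₂′ (∈-cartesianProduct⁺ (proj₂ (∈-orderedPairs i<k)) (∈-allFin j)))

  p∉phpBlocking : ∀ i j → p i j ∉ phpBlocking m n
  p∉phpBlocking i j v∈ with ∈-++⁻ (map b₁ (allFin m)) v∈
  ... | inj₁ v∈₁ with ∈-map⁻ b₁ v∈₁
  ...   | _ , _ , ()
  p∉phpBlocking i j v∈ | inj₂ v∈₂ with ∈-map⁻ b₂′ v∈₂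
  ...   | _ , _ , ()

phpVariables : ℕ → ℕ → Variables
phpVariables m n = record
  { Var             = PHPVar m n
  ; _≟ᵛ_            = _≟ᵇ_
  ; blocking        = phpBlocking m n
  ; blocking-unique = phpBlocking-unique
  }

module _ (m n : ℕ) where
  open CostSR (phpVariables m n)

  pigeonClause : Fin m → Clause
  pigeonClause i = map (λ j → pos (p i j)) (allFin n) ++ pos (b₁ i) ∷ []

  holeClause : OrderedPair m × Fin n → Clause
  holeClause (((i , k) , i<k) , j) = neg (p i j) ∷ neg (p k j) ∷ pos (b₂ i k i<k j) ∷ []

  BPHP : CNF
  BPHP = map pigeonClause (allFin m)
      ++ map holeClause (cartesianProduct (orderedPairs m) (allFin n))

{-# OPTIONS --safe #-}
module Submission where

-- Let m = n + d.  If b₂ i k j holds, its cost can be moved to b₁ k by evicting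
-- pigeon k, so every ¬ b₂ i k j is redundant.  The holes are then treated in
-- order: exchanging pigeons j and k shows that p k j → p j j is redundant for
-- k > j, after which p j j can be set to 1 and the other variables of pigeon j to
-- 0.  Since earlier pigeons are settled, the exchange preserves all earlier lines.
-- In the end pigeons 1, …, n fill the holes and resolution yields b₁ i for the
-- other d pigeons.
-- Each redundant clause C is arranged so that every restricted line is satisfied
-- or contains, up to literals of C, an available line: unit propagation is never
-- needed beyond an immediate conflict.

open import Defs
open import Data.Bool using (true; false; not)
import Data.Bool.Properties as Bool
open import Data.Bool.Properties using (not-injective)
open import Data.Empty using (⊥)
open import Data.Fin as Fin using (Fin; toℕ; fromℕ<; splitAt; _↑ˡ_; _↑ʳ_)
import Data.Fin.Properties as Fin
open import Data.List using (List; []; _∷_; _++_; map; mapMaybe; filter; length; allFin; cartesianProduct)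
open import Data.List.Membership.Propositional using (_∈_; _∉_; lose; find)
open import Data.List.Membership.Propositional.Properties
  using (∈-map⁺; ∈-map⁻; ∈-++⁺ˡ; ∈-++⁺ʳ; ∈-++⁻; ∈-∃++; ∈-filter⁺; ∈-filter⁻; ∈-allFin; ∈-cartesianProduct⁺)
open import Data.List.Properties
  using (length-++; length-map; length-filter; length-tabulate; length-mapMaybe; ++-identityʳ)
open import Data.List.Relation.Binary.Subset.Propositional using (_⊆_)
import Data.List.Relation.Unary.All as All
import Data.List.Relation.Unary.All.Properties as All
open import Data.List.Relation.Unary.AllPairs using ([]; _∷_)
open import Data.List.Relation.Unary.Any using (Any; here; there; any?)
import Data.List.Relation.Unary.Any as Any
import Data.List.Relation.Unary.Any.Properties as Any
open import Data.List.Relation.Unary.Unique.Propositional using (Unique)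
import Data.List.Relation.Unary.Unique.Propositional.Properties as Unique
open import Data.Maybe using (Maybe; just; nothing)
import Data.Maybe.Relation.Unary.All as Maybe
import Data.Maybe.Relation.Unary.Any as MaybeAny
open import Data.Nat using (ℕ; zero; suc; _+_; _*_; _≤_; _<_; _∸_; z≤n; s≤s)
open import Data.Nat.Properties
  using (≤-refl; ≤-reflexive; ≤-trans; <⇒≤; <⇒≱; n≤1+n; m≤m+n; m≤n+m; m<1+n⇒m<n∨m≡n; m≤n⇒∃[o]m+o≡n; m+n∸m≡n;
         +-suc; +-assoc; +-comm; +-mono-≤; +-monoˡ-≤; +-monoʳ-≤; *-mono-≤; *-monoˡ-≤)
open import Data.Nat.Tactic.RingSolver using (solve-∀)
open import Data.Product using (∃-syntax; _×_; _,_; proj₁; proj₂)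
open import Data.Sum using (_⊎_; inj₁; inj₂; [_,_]′; map₂)
open import Data.Unit using (⊤)
open import Function using (_∘_; id)
open import Function.Bundles using (mk⇔)
open import Relation.Binary.PropositionalEquality using (_≡_; refl; sym; trans; cong; cong₂; subst; _≢_)
open import Relation.Binary.Definitions using (tri<; tri≈; tri>)
open import Relation.Nullary using (¬_; Dec; yes; no; contradiction; recompute; ¬?)

-- The value is m + 3m²n + 3mn + n² + 2n: the axioms give m + m²n, the blocks `unblock` and `pairs`
-- give m²n each, the n stages m + n + 2 each, and the two final rounds of resolution mn each.
polynomial : Polynomial
polynomial = (1 , 1 , 0) ∷ (3 , 2 , 1) ∷ (3 , 1 , 1) ∷ (1 , 0 , 2) ∷ (2 , 0 , 1) ∷ []

-- Counting along injections and in products.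

-- Delete the image of the head from `ys`. Since the head does not recur in `xs`, injectivity on
-- members keeps the images of the tail in what is left. Costs are compared by such maps between
-- sets of true blocking variables.
length-≤-injection : ∀ {A B : Set} (g : A → B) {xs ys} → Unique xs → (∀ {x} → x ∈ xs → g x ∈ ys) →
                     (∀ {x y} → x ∈ xs → y ∈ xs → g x ≡ g y → x ≡ y) → length xs ≤ length ys
length-≤-injection g [] _ _ = z≤n
length-≤-injection g {x ∷ xs} u@(_ ∷ us) into inj with ∈-∃++ (into (here refl))
... | as , bs , refl = ≤-trans
  (s≤s (length-≤-injection g us into′ (λ y∈ z∈ → inj (there y∈) (there z∈))))
  (≤-reflexive (trans (cong suc (length-++ as)) (trans (sym (+-suc _ _)) (sym (length-++ as)))))
  where
  into′ : ∀ {y} → y ∈ xs → g y ∈ as ++ bs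
  into′ y∈ with ∈-++⁻ as (into (there y∈))
  ... | inj₁ ∈as         = ∈-++⁺ˡ ∈as
  ... | inj₂ (there ∈bs) = ∈-++⁺ʳ as ∈bs
  ... | inj₂ (here eq)   = contradiction
    (subst (_∈ xs) (inj (there y∈) (here refl) eq) y∈) (Unique.Unique[x∷xs]⇒x∉xs u)

length-allFin : ∀ k → length (allFin k) ≡ k
length-allFin k = length-tabulate {n = k} id

length-cartesianProduct : ∀ {A B : Set} (xs : List A) (ys : List B) →
                          length (cartesianProduct xs ys) ≡ length xs * length ys
length-cartesianProduct []       ys = refl
length-cartesianProduct (x ∷ xs) ys = trans (length-++ (map (x ,_) ys))
  (cong₂ _+_ (length-map (x ,_) ys) (length-cartesianProduct xs ys))

-- General facts about the cost-SR calculus.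

module Calculus (V : Variables) where
  open Variables V
  open CostSR V
  open import Data.List.Membership.DecPropositional _≟ˡ_ using (_∈?_)

  negate-≢ : ∀ ℓ → negate ℓ ≢ ℓ
  negate-≢ (pos x) ()
  negate-≢ (neg x) ()

  singleton-nonTautological : ∀ ℓ → ¬ Tautological (ℓ ∷ [])
  singleton-nonTautological ℓ (here (here eq)) = negate-≢ ℓ eq

  ∈⇒∈ᶜ : ∀ {C Γ} → C ∈ Γ → C ∈ᶜ Γ
  ∈⇒∈ᶜ = Any.map λ { refl → mk⇔ id id }

  -- Restriction by partial assignments

  module _ {C : Clause} (nt : ¬ Tautological C) where

    -- `falsify` tests for `pos x` first, so if both literals of x were in `C`, it would make
    -- `neg x` true; `nt` excludes this.
    falsify-∈ : ∀ {ℓ} → ℓ ∈ C → apply (falsify C) ℓ ≡ const false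
    falsify-∈ {pos x} ℓ∈ with pos x ∈? C
    ... | yes _ = refl
    ... | no ℓ∉ = contradiction ℓ∈ ℓ∉
    falsify-∈ {neg x} ℓ∈ with pos x ∈? C | neg x ∈? C
    ... | yes p∈ | _     = contradiction (lose ℓ∈ p∈) nt
    ... | no _   | yes _ = refl
    ... | no _   | no ℓ∉ = contradiction ℓ∈ ℓ∉

  falsify-∉ : ∀ {C} ℓ → ℓ ∉ C → negate ℓ ∉ C → apply (falsify C) ℓ ≡ lit ℓ
  falsify-∉ {C} (pos x) ℓ∉ ¬ℓ∉ with pos x ∈? C | neg x ∈? C
  ... | yes ℓ∈ | _       = contradiction ℓ∈ ℓ∉
  ... | no _   | yes ¬ℓ∈ = contradiction ¬ℓ∈ ¬ℓ∉
  ... | no _   | no _    = refl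
  falsify-∉ {C} (neg x) ℓ∉ ¬ℓ∉ with pos x ∈? C | neg x ∈? C
  ... | yes ¬ℓ∈ | _      = contradiction ¬ℓ∈ ¬ℓ∉
  ... | no _    | yes ℓ∈ = contradiction ℓ∈ ℓ∉
  ... | no _    | no _   = refl

  ∈-mapMaybe-getLiteral⁻ : ∀ {ℓ} vs → ℓ ∈ mapMaybe getLiteral vs → lit ℓ ∈ vs
  ∈-mapMaybe-getLiteral⁻ (const _ ∷ vs) ℓ∈          = there (∈-mapMaybe-getLiteral⁻ vs ℓ∈)
  ∈-mapMaybe-getLiteral⁻ (lit _ ∷ vs)   (here refl) = here refl
  ∈-mapMaybe-getLiteral⁻ (lit _ ∷ vs)   (there ℓ∈)  = there (∈-mapMaybe-getLiteral⁻ vs ℓ∈)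

  ∈-mapMaybe-getLiteral⁺ : ∀ {ℓ vs} → lit ℓ ∈ vs → ℓ ∈ mapMaybe getLiteral vs
  ∈-mapMaybe-getLiteral⁺ {vs = const _ ∷ vs} (there ℓ∈)  = ∈-mapMaybe-getLiteral⁺ ℓ∈
  ∈-mapMaybe-getLiteral⁺ {vs = lit _ ∷ vs}   (here refl) = here refl
  ∈-mapMaybe-getLiteral⁺ {vs = lit _ ∷ vs}   (there ℓ∈)  = there (∈-mapMaybe-getLiteral⁺ ℓ∈)

  Tautological-⊆ : ∀ {C D} → C ⊆ D → Tautological C → Tautological D
  Tautological-⊆ C⊆D t with find t
  ... | _ , ℓ∈ , ¬ℓ∈ = lose (C⊆D ℓ∈) (C⊆D ¬ℓ∈)

  getLiteral-⊆ : ∀ {ρ E D} →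
                 (∀ {ℓ} → ℓ ∈ E → apply ρ ℓ ≡ const false ⊎ (apply ρ ℓ ≡ lit ℓ × ℓ ∈ D)) →
                 mapMaybe getLiteral (map (apply ρ) E) ⊆ D
  getLiteral-⊆ {ρ} h ℓ∈ with ∈-map⁻ (apply ρ) (∈-mapMaybe-getLiteral⁻ _ ℓ∈)
  ... | ℓ′ , ℓ′∈ , eq with apply ρ ℓ′ | h ℓ′∈
  getLiteral-⊆ h ℓ∈ | _ , _ , refl | _ | inj₂ (refl , ∈D) = ∈D

  -- No literal of `E` becomes true, and the surviving ones lie in the non-tautological `D`. So
  -- neither reason for discarding a restricted clause can apply.
  restrict-⊆ : ∀ {ρ E D} → ¬ Tautological D →
               (∀ {ℓ} → ℓ ∈ E → apply ρ ℓ ≡ const false ⊎ (apply ρ ℓ ≡ lit ℓ × ℓ ∈ D)) →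
               ∃[ F ] (E ↾ᶜ ρ ≡ just F × F ⊆ D)
  restrict-⊆ {ρ} {E} {D} nt h
    with any? isTrue? (map (apply ρ) E) | tautological? (mapMaybe getLiteral (map (apply ρ) E))
  ... | yes t | _     = contradiction t untrue
    where
    untrue : ¬ Any IsTrue (map (apply ρ) E)
    untrue t with find (Any.map⁻ t)
    ... | ℓ , ℓ∈ , tr with apply ρ ℓ | h ℓ∈
    untrue t | _ , _ , () | _ | inj₁ refl
    untrue t | _ , _ , () | _ | inj₂ (refl , _)
  ... | no _  | yes t = contradiction (Tautological-⊆ (getLiteral-⊆ h) t) nt
  ... | no _  | no _  = _ , refl , getLiteral-⊆ h

  ∈-↾ : ∀ {ρ E F Γ} → E ∈ Γ → E ↾ᶜ ρ ≡ just F → F ∈ Γ ↾ ρ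
  ∈-↾ {ρ} {E} {F} E∈ eq = Any.mapMaybe⁺ (_↾ᶜ ρ) _ (Any.map⁺ (Any.map
    (λ { refl → subst (MaybeAny.Any (F ≡_)) (sym eq) (MaybeAny.just refl) }) E∈))

  -- Clauses implied after restriction

  -- A conflict is reached without propagation: E restricted by ¬C is a
  -- subclause of D restricted by σ.
  data Preserved (Γ : CNF) (C : Clause) (σ : Substitution) (D : Clause) : Set where
    satisfied : ∀ {ℓ} → ℓ ∈ D → apply σ ℓ ≡ const true → Preserved Γ C σ D
    subsumed  : ∀ {E} → E ∈ Γ →
                (∀ {ℓ} → ℓ ∈ E → ℓ ∈ C ⊎ ∃[ ℓ′ ] (ℓ′ ∈ D × apply σ ℓ′ ≡ lit ℓ)) →
                Preserved Γ C σ D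

  Preserved-⊆ : ∀ {Γ C σ D D′} → D ⊆ D′ → Preserved Γ C σ D → Preserved Γ C σ D′
  Preserved-⊆ D⊆D′ (satisfied ℓ∈ eq) = satisfied (D⊆D′ ℓ∈) eq
  Preserved-⊆ D⊆D′ (subsumed E∈ h) = subsumed E∈ λ ℓ∈ →
    [ inj₁ , (λ (ℓ′ , ℓ′∈ , eq) → inj₂ (ℓ′ , D⊆D′ ℓ′∈ , eq)) ]′ (h ℓ∈)

  unaffected : ∀ {Γ C σ D} → D ∈ Γ → (∀ {ℓ} → ℓ ∈ D → apply σ ℓ ≡ lit ℓ) → Preserved Γ C σ D
  unaffected D∈ h = subsumed D∈ λ ℓ∈ → inj₂ (_ , ℓ∈ , h ℓ∈)

  falsified : ∀ {C} → ¬ Tautological C → ∀ τ → τ ⊇ falsify C → ∀ {ℓ} → ℓ ∈ C → evalLiteral τ ℓ ≡ false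
  falsified nt τ τ⊇ {pos x} ℓ∈ = τ⊇ x false (falsify-∈ nt ℓ∈)
  falsified {C} nt τ τ⊇ {neg x} ℓ∈ = cong not (τ⊇ x true (¬ᵛ-false (falsify C x) (falsify-∈ nt ℓ∈)))
    where
    ¬ᵛ-false : ∀ v → ¬ᵛ v ≡ const false → v ≡ const true
    ¬ᵛ-false (const true) _ = refl

  module _ {Γ : CNF} {C : Clause} {σ : Substitution} (nt : ¬ Tautological C)
           (fresh : ∀ (x : Var) {ℓ : Literal} → σ x ≡ lit ℓ → ∀ {ℓ′ : Literal} → ℓ′ ∈ C → var ℓ ≢ var ℓ′) where

    private
      var-negate : ∀ ℓ → var (negate ℓ) ≡ var ℓ
      var-negate (pos x) = refl
      var-negate (neg x) = refl

      apply-lit : ∀ ℓ {ℓ′} → apply σ ℓ ≡ lit ℓ′ → ∃[ ℓ″ ] (σ (var ℓ) ≡ lit ℓ″ × var ℓ″ ≡ var ℓ′)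
      apply-lit (pos x) eq = _ , eq , refl
      apply-lit (neg x) eq with σ x
      apply-lit (neg x) refl | lit ℓ = ℓ , refl , sym (var-negate ℓ)

    -- By `fresh`, restricting by ¬C falsifies the literals of `E` in `C` and leaves those from the
    -- image of `D` alone. `E` thus shrinks to a subclause of `D` restricted by σ, and falsifying
    -- the latter turns it into the empty clause.
    preserved⇒implied : ∀ {D} → Preserved Γ C σ D →
                        Maybe.All (λ D′ → (Γ ↾ falsify C) ⊢₁ D′) (D ↾ᶜ σ)
    preserved⇒implied {D} pr
      with any? isTrue? (map (apply σ) D) | tautological? (mapMaybe getLiteral (map (apply σ) D))
    ... | yes _ | _     = Maybe.nothing
    ... | no _  | yes _ = Maybe.nothing
    ... | no nT | no ntD with pr
    ...   | satisfied ℓ∈ eq = contradiction (Any.map⁺ (lose ℓ∈ (subst IsTrue (sym eq) isTrue))) nT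
    ...   | subsumed {E} E∈ h = Maybe.just (refute (restrict-⊆ ntD first))
      where
      D′ = mapMaybe getLiteral (map (apply σ) D)

      first : ∀ {ℓ} → ℓ ∈ E → apply (falsify C) ℓ ≡ const false ⊎
              (apply (falsify C) ℓ ≡ lit ℓ × ℓ ∈ D′)
      first {ℓ} ℓ∈ with h ℓ∈
      ... | inj₁ ∈C = inj₁ (falsify-∈ nt ∈C)
      ... | inj₂ (ℓ′ , ℓ′∈ , eq) with apply-lit ℓ′ eq
      ...   | ℓ″ , σx , veq = inj₂
        ( falsify-∉ ℓ (λ ∈C → fresh _ σx ∈C veq)
                      (λ ∈C → fresh _ σx ∈C (trans veq (sym (var-negate ℓ))))
        , ∈-mapMaybe-getLiteral⁺ (subst (_∈ _) eq (∈-map⁺ (apply σ) ℓ′∈)))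

      refute : ∃[ F ] (E ↾ᶜ falsify C ≡ just F × F ⊆ D′) → (Γ ↾ falsify C) ⊢₁ D′
      refute (F , eq , F⊆) with restrict-⊆ {falsify D′} {F} {[]} (λ ()) (λ ℓ∈ → inj₁ (falsify-∈ ntD (F⊆ ℓ∈)))
      ... | []    , eq′ , _   = conflict (∈⇒∈ᶜ (∈-↾ (∈-↾ E∈ eq) eq′))
      ... | _ ∷ _ , _   , G⊆  with G⊆ (here refl)
      ...   | ()

    isCostSR : (∀ {D} → D ∈ C ∷ Γ → Preserved Γ C σ D) →
               (∀ τ → τ ⊇ falsify C → cost (τ ∘ˢ σ) ≤ cost τ) → IsCostSR Γ C
    isCostSR pr c = record
      { nonTautological = nt
      ; σ = σ
      ; implied = All.mapMaybe⁺ {xs = C ∷ Γ} {f = _↾ᶜ σ} (All.map⁺ (All.tabulate λ {D} D∈ → preserved⇒implied {D} (pr D∈)))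
      ; cost-≤ = c }

  -- Costs

  private
    trues : Assignment → List Var
    trues τ = filter (λ x → τ x Bool.≟ true) blocking

    ∈-trues⁺ : ∀ τ {x} → x ∈ blocking → τ x ≡ true → x ∈ trues τ
    ∈-trues⁺ τ = ∈-filter⁺ (λ x → τ x Bool.≟ true)

    ∈-trues⁻ : ∀ τ {x} → x ∈ trues τ → x ∈ blocking × τ x ≡ true
    ∈-trues⁻ τ = ∈-filter⁻ (λ x → τ x Bool.≟ true) {xs = blocking}

    trues-unique : ∀ τ → Unique (trues τ)
    trues-unique τ = Unique.filter⁺ (λ x → τ x Bool.≟ true) blocking-unique

  cost-mono : ∀ τ′ τ → (∀ {x} → x ∈ blocking → τ′ x ≡ true → τ x ≡ true) → cost τ′ ≤ cost τ
  cost-mono τ′ τ h = length-≤-injection id {ys = trues τ} (trues-unique τ′)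
    (λ x∈ → let x∈b , t = ∈-trues⁻ τ′ x∈ in ∈-trues⁺ τ x∈b (h x∈b t)) (λ _ _ → id)

  -- The map sending `y` to `x` and fixing everything else takes the variables true under `τ′` to
  -- variables true under `τ`. It is injective because `x` itself is false under `τ′`.
  cost-move : ∀ τ′ τ x y → x ∈ blocking → τ′ x ≡ false → (τ′ y ≡ true → τ x ≡ true) →
              (∀ {z} → z ∈ blocking → z ≢ y → τ′ z ≡ true → τ z ≡ true) → cost τ′ ≤ cost τ
  cost-move τ′ τ x y x∈b τ′x hy h = length-≤-injection move {ys = trues τ} (trues-unique τ′) into inj
    where
    move : Var → Var
    move z with z ≟ᵛ y
    ... | yes _ = x
    ... | no _  = z

    into : ∀ {z} → z ∈ trues τ′ →
           move z ∈ trues τ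
    into {z} z∈ with ∈-trues⁻ τ′ z∈ | z ≟ᵛ y
    ... | z∈b , t | yes refl = ∈-trues⁺ τ x∈b (hy t)
    ... | z∈b , t | no z≢    = ∈-trues⁺ τ z∈b (h z∈b z≢ t)

    notx : ∀ {z} → z ∈ trues τ′ → z ≢ x
    notx z∈ refl with trans (sym τ′x) (proj₂ (∈-trues⁻ τ′ z∈))
    ... | ()

    inj : ∀ {z w} → z ∈ trues τ′ →
          w ∈ trues τ′ → move z ≡ move w → z ≡ w
    inj {z} {w} z∈ w∈ eq with z ≟ᵛ y | w ≟ᵛ y
    ... | yes refl | yes refl = refl
    ... | yes _    | no _     = contradiction (sym eq) (notx w∈)
    ... | no _     | yes _    = contradiction eq (notx z∈)
    ... | no _     | no _     = eq

  -- Redundancy of a unit clause by setting its literal to true.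

  [_]≔true : Literal → Substitution
  [ pos y ]≔true x with x ≟ᵛ y
  ... | yes _ = const true
  ... | no _  = lit (pos x)
  [ neg y ]≔true x with x ≟ᵛ y
  ... | yes _ = const false
  ... | no _  = lit (pos x)

  []≔true-self : ∀ μ → apply [ μ ]≔true μ ≡ const true
  []≔true-self (pos y) with y ≟ᵛ y
  ... | yes _ = refl
  ... | no ≢  = contradiction refl ≢
  []≔true-self (neg y) with y ≟ᵛ y
  ... | yes _ = refl
  ... | no ≢  = contradiction refl ≢

  []≔true-other : ∀ μ x → x ≢ var μ → [ μ ]≔true x ≡ lit (pos x)
  []≔true-other (pos y) x x≢ with x ≟ᵛ y
  ... | yes eq = contradiction eq x≢
  ... | no _   = refl
  []≔true-other (neg y) x x≢ with x ≟ᵛ y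
  ... | yes eq = contradiction eq x≢
  ... | no _   = refl

  apply-other : ∀ σ ℓ → σ (var ℓ) ≡ lit (pos (var ℓ)) → apply σ ℓ ≡ lit ℓ
  apply-other σ (pos x) eq = eq
  apply-other σ (neg x) eq rewrite eq = refl

  same-var : ∀ ℓ μ → var ℓ ≡ var μ → ℓ ≡ μ ⊎ ℓ ≡ negate μ
  same-var (pos x) (pos _) refl = inj₁ refl
  same-var (pos x) (neg _) refl = inj₂ refl
  same-var (neg x) (pos _) refl = inj₂ refl
  same-var (neg x) (neg _) refl = inj₁ refl

  -- Once μ is set to 1, only clauses that contain ¬μ and lack μ lose a literal. For them a source
  -- `E` is required, in which μ may occur because ¬C falsifies it. The cost could grow only if μ
  -- were a positive blocking literal.
  satisfy : ∀ {Γ} μ →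
            (∀ {D} → D ∈ Γ → negate μ ∈ D →
              ∃[ E ] (E ∈ Γ × (∀ {ℓ} → ℓ ∈ E → ℓ ≡ μ ⊎ (ℓ ∈ D × ℓ ≢ negate μ)))) →
            (∀ {x} → μ ≡ pos x → x ∉ blocking) →
            IsCostSR Γ (μ ∷ [])
  satisfy {Γ} μ h nb = isCostSR (singleton-nonTautological μ) fresh pr λ τ _ → cost-mono _ τ (mono μ nb τ)
    where
    fresh : ∀ x {ℓ} → [ μ ]≔true x ≡ lit ℓ → ∀ {ℓ′} → ℓ′ ∈ μ ∷ [] → var ℓ ≢ var ℓ′
    fresh x {ℓ} eq (here refl) veq with x ≟ᵛ var μ
    ... | no x≢ with trans (sym ([]≔true-other μ x x≢)) eq
    ...   | refl = x≢ veq
    fresh x {ℓ} eq (here refl) veq | yes refl = lemma μ eq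
      where
      lemma : ∀ μ {ℓ} → [ μ ]≔true (var μ) ≢ lit ℓ
      lemma (pos y) eq with y ≟ᵛ y
      lemma (pos y) () | yes _
      ... | no ≢ = ≢ refl
      lemma (neg y) eq with y ≟ᵛ y
      lemma (neg y) () | yes _
      ... | no ≢ = ≢ refl

    mono : ∀ μ → (∀ {x} → μ ≡ pos x → x ∉ blocking) → ∀ τ {x} → x ∈ blocking →
           (τ ∘ˢ [ μ ]≔true) x ≡ true → τ x ≡ true
    mono (pos y) nb τ {x} x∈ eq with x ≟ᵛ y
    ... | yes refl = contradiction x∈ (nb refl)
    ... | no _     = eq
    mono (neg y) nb τ {x} x∈ eq with x ≟ᵛ y
    mono (neg y) nb τ {x} x∈ () | yes refl
    ... | no _     = eq

    other : ∀ {ℓ} → ℓ ≢ μ → ℓ ≢ negate μ → apply [ μ ]≔true ℓ ≡ lit ℓ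
    other {ℓ} ≢₁ ≢₂ = apply-other [ μ ]≔true ℓ
      ([]≔true-other μ (var ℓ) λ veq → [ ≢₁ , ≢₂ ]′ (same-var ℓ μ veq))

    pr : ∀ {D} → D ∈ (μ ∷ []) ∷ Γ → Preserved Γ (μ ∷ []) [ μ ]≔true D
    pr (here refl) = satisfied (here refl) ([]≔true-self μ)
    pr {D} (there D∈) with μ ∈? D | negate μ ∈? D
    ... | yes μ∈ | _      = satisfied μ∈ ([]≔true-self μ)
    ... | no μ∉  | no ¬μ∉ = unaffected D∈ λ ℓ∈ →
      other (λ { refl → μ∉ ℓ∈ }) (λ { refl → ¬μ∉ ℓ∈ })
    ... | no μ∉  | yes ¬μ∈ with h D∈ ¬μ∈
    ...   | E , E∈ , hE = subsumed E∈ λ ℓ∈ → sub (hE ℓ∈)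
      where
      sub : ∀ {ℓ} → ℓ ≡ μ ⊎ (ℓ ∈ D × ℓ ≢ negate μ) →
            ℓ ∈ μ ∷ [] ⊎ ∃[ ℓ′ ] (ℓ′ ∈ D × apply [ μ ]≔true ℓ′ ≡ lit ℓ)
      sub (inj₁ refl) = inj₁ (here refl)
      sub (inj₂ (ℓ∈ , ≢)) = inj₂ (_ , ℓ∈ , other (λ { refl → μ∉ ℓ∈ }) ≢)

  -- Derivations built block by block.

  record Derivable (Γ : CNF) (L U : Clause → Set) (s : ℕ) : Set where
    field
      lines      : List Clause
      derivation : Derivation Γ lines
      -- Two bounds are kept on the set of lines: `lower` provides premises and sources, while
      -- `upper` limits the lines that a redundancy step has to preserve.
      lower      : ∀ {D} → L D → D ∈ lines
      upper      : ∀ {D} → D ∈ lines → U D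
      size       : length lines ≤ s

  weaken-size : ∀ {Γ L U s s′} → s ≤ s′ → Derivable Γ L U s → Derivable Γ L U s′
  weaken-size s≤ d = record
    { Derivable d hiding (size) ; size = ≤-trans (Derivable.size d) s≤ }

  -- The block is derived from the end of `xs`, so a new line sees all old lines and an unspecified
  -- part of the block. Hence `step` has to work for every `Ds` between `L` and `U′`.
  extend : ∀ {Γ L U L′ U′ s} {A : Set} (f : A → Clause) (xs : List A) →
           (∀ {D} → U D → U′ D) → (∀ {x} → x ∈ xs → U′ (f x)) →
           (∀ {D} → L′ D → L D ⊎ D ∈ map f xs) →
           (∀ {Ds x} → (∀ {D} → L D → D ∈ Ds) → (∀ {D} → D ∈ Ds → U′ D) → x ∈ xs → Step Γ Ds (f x)) →
           Derivable Γ L U s → Derivable Γ L′ U′ (length xs + s)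
  extend {Γ} {L} {U} {L′} {U′} {s} f xs U⊆ fU L′⊆ step d = record
    { lines = map f xs ++ lines
    ; derivation = go xs id
    ; lower = λ l → [ ∈-++⁺ʳ (map f xs) ∘ lower , ∈-++⁺ˡ ]′ (L′⊆ l)
    ; upper = upper′ xs id
    ; size = ≤-trans (≤-reflexive (trans (length-++ (map f xs)) (cong (_+ length lines) (length-map f xs))))
                     (+-monoʳ-≤ (length xs) size)
    }
    where
    open Derivable d
    upper′ : ∀ ys → ys ⊆ xs → ∀ {D} → D ∈ map f ys ++ lines → U′ D
    upper′ ys ys⊆ D∈ with ∈-++⁻ (map f ys) D∈
    ... | inj₂ ∈l = U⊆ (upper ∈l)
    ... | inj₁ ∈f with ∈-map⁻ f ∈f
    ...   | _ , y∈ , refl = fU (ys⊆ y∈)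

    go : ∀ ys → ys ⊆ xs → Derivation Γ (map f ys ++ lines)
    go [] _ = derivation
    go (y ∷ ys) ys⊆ = step (∈-++⁺ʳ (map f ys) ∘ lower) (upper′ ys (ys⊆ ∘ there)) (ys⊆ (here refl))
                      ∷ go ys (ys⊆ ∘ there)

-- The clauses derived from BPHP.

module BlockedPigeonhole (n d : ℕ) where

  m = n + d

  open CostSR (phpVariables m n)
  open Calculus (phpVariables m n)

  Triple : Set
  Triple = OrderedPair m × Fin n

  triples : List Triple
  triples = cartesianProduct (orderedPairs m) (allFin n)

  ∈-triples : ∀ q → q ∈ triples
  ∈-triples (((i , k) , i<k) , j) with ∈-orderedPairs i<k
  ... | i<k′ , q∈ = ∈-cartesianProduct⁺
    (subst (λ lt → ((i , k) , lt) ∈ orderedPairs m) (Fin.<-irrelevant i<k′ i<k) q∈) (∈-allFin j)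

  low : Fin n → Fin m
  low j = j ↑ˡ d

  high : Fin d → Fin m
  high i = n ↑ʳ i

  data Split : Fin m → Set where
    isLow  : ∀ j → Split (low j)
    isHigh : ∀ i → Split (high i)

  split : ∀ k → Split k
  split k with splitAt n k in eq
  ... | inj₁ j = subst Split (Fin.splitAt⁻¹-↑ˡ eq) (isLow j)
  ... | inj₂ i = subst Split (Fin.splitAt⁻¹-↑ʳ {n} eq) (isHigh i)

  low<high : ∀ j i → low j Fin.< high i
  low<high j i rewrite Fin.toℕ-↑ˡ j d | Fin.toℕ-↑ʳ n i = ≤-trans (Fin.toℕ<n j) (m≤m+n n (toℕ i))

  low-reflects-< : ∀ {j j′} → low j Fin.< low j′ → j Fin.< j′
  low-reflects-< {j} {j′} lt rewrite Fin.toℕ-↑ˡ j d | Fin.toℕ-↑ˡ j′ d = lt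

  low-mono-< : ∀ {j j′} → j Fin.< j′ → low j Fin.< low j′
  low-mono-< {j} {j′} lt rewrite Fin.toℕ-↑ˡ j d | Fin.toℕ-↑ˡ j′ d = lt

  low-injective : ∀ {j j′} → low j ≡ low j′ → j ≡ j′
  low-injective {j} {j′} = Fin.↑ˡ-injective d j j′

  pairClause : Triple → Clause
  pairClause (((i , k) , _) , j) = neg (p i j) ∷ neg (p k j) ∷ []

  dominanceClause : Fin n → Fin m → Clause
  dominanceClause j k = neg (p k j) ∷ pos (p (low j) j) ∷ []

  -- The other variables of the clause of pigeon j, once it sits in hole j.
  data Off (j : Fin n) : PHPVar m n → Set where
    offᵇ : Off j (b₁ (low j))
    offᵖ : ∀ {l} → l ≢ j → Off j (p (low j) l)

  -- t ≥ 1: the b₂ are false; t ≥ 2: no hole is shared; a, b, c: the numbers of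
  -- holes j for which, in turn, p j j dominates the later pigeons' claims to j,
  -- p j j holds, and the remaining variables of pigeon j are false.
  data Line (t a b c : ℕ) : Clause → Set where
    pigeon    : ∀ i → Line t a b c (pigeonClause m n i)
    hole      : ∀ q → Line t a b c (holeClause m n q)
    unblocked : ∀ q → 1 ≤ t → Line t a b c (neg (b₂′ q) ∷ [])
    pair      : ∀ q → 2 ≤ t → Line t a b c (pairClause q)
    dominance : ∀ j {k} → low j Fin.< k → toℕ j < a → Line t a b c (dominanceClause j k)
    diagonal  : ∀ j → toℕ j < b → Line t a b c (pos (p (low j) j) ∷ [])
    off       : ∀ j {v} → Off j v → toℕ j < c → Line t a b c (neg v ∷ [])

  Line-mono : ∀ {t t′ a a′ b b′ c c′} → t ≤ t′ → a ≤ a′ → b ≤ b′ → c ≤ c′ →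
              ∀ {D} → Line t a b c D → Line t′ a′ b′ c′ D
  Line-mono t a b c (pigeon i)         = pigeon i
  Line-mono t a b c (hole q)           = hole q
  Line-mono t a b c (unblocked q x)    = unblocked q (≤-trans x t)
  Line-mono t a b c (pair q x)         = pair q (≤-trans x t)
  Line-mono t a b c (dominance j lt x) = dominance j lt (≤-trans x a)
  Line-mono t a b c (diagonal j x)     = diagonal j (≤-trans x b)
  Line-mono t a b c (off j o x)        = off j o (≤-trans x c)

  pigeon∈BPHP : ∀ i → pigeonClause m n i ∈ BPHP m n
  pigeon∈BPHP i = ∈-++⁺ˡ (∈-map⁺ (pigeonClause m n) (∈-allFin i))

  hole∈BPHP : ∀ q → holeClause m n q ∈ BPHP m n
  hole∈BPHP q = ∈-++⁺ʳ (map (pigeonClause m n) (allFin m)) (∈-map⁺ (holeClause m n) (∈-triples q))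

  BPHP⇒Line : ∀ {t a b c D} → D ∈ BPHP m n → Line t a b c D
  BPHP⇒Line D∈ with ∈-++⁻ (map (pigeonClause m n) (allFin m)) D∈
  ... | inj₁ D∈p with ∈-map⁻ (pigeonClause m n) D∈p
  ...   | i , _ , refl = pigeon i
  BPHP⇒Line D∈ | inj₂ D∈h with ∈-map⁻ (holeClause m n) D∈h
  ...   | q , _ , refl = hole q

  p∈pigeon : ∀ i j → pos (p i j) ∈ pigeonClause m n i
  p∈pigeon i j = ∈-++⁺ˡ (∈-map⁺ (λ j → pos (p i j)) (∈-allFin j))

  b∈pigeon : ∀ i → pos (b₁ i) ∈ pigeonClause m n i
  b∈pigeon i = ∈-++⁺ʳ (map (λ j → pos (p i j)) (allFin n)) (here refl)

  data PigeonLiteral (i : Fin m) : Literal → Set where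
    isP : ∀ j → PigeonLiteral i (pos (p i j))
    isB : PigeonLiteral i (pos (b₁ i))

  ∈-pigeon⁻ : ∀ {i ℓ} → ℓ ∈ pigeonClause m n i → PigeonLiteral i ℓ
  ∈-pigeon⁻ {i} ℓ∈ with ∈-++⁻ (map (λ j → pos (p i j)) (allFin n)) ℓ∈
  ... | inj₂ (here refl) = isB
  ... | inj₁ ℓ∈p with ∈-map⁻ (λ j → pos (p i j)) ℓ∈p
  ...   | j , _ , refl = isP j

  occurs : ∀ v → v occursIn BPHP m n
  occurs (p i j) = lose (pigeon∈BPHP i) (lose (p∈pigeon i j) refl)
  occurs (b₁ i)  = lose (pigeon∈BPHP i) (lose (b∈pigeon i) refl)
  -- The order proof inside `b₂` is irrelevant; deciding the order again yields the relevant one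
  -- that an `OrderedPair` stores.
  occurs (b₂ i k i<k j) = lose (hole∈BPHP (((i , k) , recompute (i Fin.<? k) i<k) , j))
                               (there (there (here refl)))

  pair⊆hole : ∀ q → pairClause q ⊆ holeClause m n q
  pair⊆hole q (here refl)         = here refl
  pair⊆hole q (there (here refl)) = there (here refl)

  -- Redundancy of the clauses ¬ b₂ i k j.

  module Unblock (i k : Fin m) (i<k : i Fin.< k) (j : Fin n) where

    v : PHPVar m n
    v = b₂ i k i<k j

    -- With pigeon `k` out of every hole, all hole clauses about `k` hold, including the one blocked
    -- by `v`; its pigeon clause holds through `b₁ k`.
    σ : Substitution
    σ (p i′ l) with i′ Fin.≟ k
    ... | yes _ = const false
    ... | no _  = lit (pos (p i′ l))
    σ (b₁ i′) with i′ Fin.≟ k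
    ... | yes _ = const true
    ... | no _  = lit (pos (b₁ i′))
    σ (b₂ x y x<y l) with b₂ x y x<y l ≟ᵇ v
    ... | yes _ = const false
    ... | no _  = lit (pos (b₂ x y x<y l))

    σ-p≡ : ∀ l → σ (p k l) ≡ const false
    σ-p≡ l with k Fin.≟ k
    ... | yes _ = refl
    ... | no ≢  = contradiction refl ≢

    σ-p≢ : ∀ {i′} l → i′ ≢ k → σ (p i′ l) ≡ lit (pos (p i′ l))
    σ-p≢ {i′} l ≢ with i′ Fin.≟ k
    ... | yes eq = contradiction eq ≢
    ... | no _   = refl

    σ-b₁≡ : σ (b₁ k) ≡ const true
    σ-b₁≡ with k Fin.≟ k
    ... | yes _ = refl
    ... | no ≢  = contradiction refl ≢

    σ-b₁≢ : ∀ {i′} → i′ ≢ k → σ (b₁ i′) ≡ lit (pos (b₁ i′))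
    σ-b₁≢ {i′} ≢ with i′ Fin.≟ k
    ... | yes eq = contradiction eq ≢
    ... | no _   = refl

    σ-v : σ v ≡ const false
    σ-v with v ≟ᵇ v
    ... | yes _ = refl
    ... | no ≢  = contradiction refl ≢

    σ-b₂≢ : ∀ {x y l} .{x<y} → b₂ x y x<y l ≢ v → σ (b₂ x y x<y l) ≡ lit (pos (b₂ x y x<y l))
    σ-b₂≢ {x} {y} {l} {x<y} ≢ with b₂ x y x<y l ≟ᵇ v
    ... | yes eq = contradiction eq ≢
    ... | no _   = refl

    fresh : ∀ x {ℓ} → σ x ≡ lit ℓ → ∀ {ℓ′} → ℓ′ ∈ neg v ∷ [] → var ℓ ≢ var ℓ′
    fresh (p i′ l) eq (here refl) with i′ Fin.≟ k
    fresh (p i′ l) refl (here refl) | no _ = λ ()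
    fresh (b₁ i′) eq (here refl) with i′ Fin.≟ k
    fresh (b₁ i′) refl (here refl) | no _ = λ ()
    fresh (b₂ x y x<y l) eq (here refl) with b₂ x y x<y l ≟ᵇ v
    fresh (b₂ x y x<y l) refl (here refl) | no ≢ = ≢

    preserved : ∀ {Γ} → (∀ {D} → D ∈ Γ → Line 1 0 0 0 D) →
                ∀ {D} → D ∈ (neg v ∷ []) ∷ Γ → Preserved Γ (neg v ∷ []) σ D
    preserved up (here refl) = satisfied (here refl) (cong ¬ᵛ_ σ-v)
    preserved up (there D∈) with up D∈
    preserved up (there D∈) | pair _ (s≤s ())
    preserved up (there D∈) | pigeon i′ with i′ Fin.≟ k
    ... | yes refl = satisfied (b∈pigeon k) σ-b₁≡
    ... | no i′≢k  = unaffected D∈ λ ℓ∈ → literal (∈-pigeon⁻ ℓ∈)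
      where
      literal : ∀ {ℓ} → PigeonLiteral i′ ℓ → apply σ ℓ ≡ lit ℓ
      literal (isP l) = σ-p≢ l i′≢k
      literal isB     = σ-b₁≢ i′≢k
    preserved up (there D∈) | hole (((x , y) , x<y) , l) with x Fin.≟ k | y Fin.≟ k
    ... | yes refl | _        = satisfied (here refl) (cong ¬ᵛ_ (σ-p≡ l))
    ... | no _     | yes refl = satisfied (there (here refl)) (cong ¬ᵛ_ (σ-p≡ l))
    ... | no x≢k   | no y≢k   = unaffected D∈ λ where
      (here refl)                 → cong ¬ᵛ_ (σ-p≢ l x≢k)
      (there (here refl))         → cong ¬ᵛ_ (σ-p≢ l y≢k)
      -- The second pigeon of `v` is `k`, so this blocking variable is not `v`.
      (there (there (here refl))) → σ-b₂≢ λ { refl → y≢k refl }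
    -- The upper bound leaves open which units of this block are present, possibly ¬v itself.
    preserved up (there D∈) | unblocked q@(((x , y) , x<y) , l) _ with b₂′ q ≟ᵇ v
    ... | yes eq = satisfied (here refl) (cong ¬ᵛ_ (trans (cong σ eq) σ-v))
    ... | no ≢   = unaffected D∈ λ { (here refl) → cong ¬ᵛ_ (σ-b₂≢ ≢) }

    redundant : ∀ {Γ} → (∀ {D} → D ∈ Γ → Line 1 0 0 0 D) → IsCostSR Γ (neg v ∷ [])
    redundant up = isCostSR nt fresh (preserved up) λ τ τ⊇ →
      -- An extension of ¬C has `v` true; σ makes `v` false, and the cost saved there covers `b₁ k`.
      cost-move (τ ∘ˢ σ) τ v (b₁ k) (b₂∈phpBlocking i<k j) (cong (eval τ) σ-v)
        (λ _ → not-injective (falsified nt τ τ⊇ (here refl))) (rest τ)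
      where
      nt = singleton-nonTautological (neg v)

      rest : ∀ τ {z} → z ∈ phpBlocking m n → z ≢ b₁ k → (τ ∘ˢ σ) z ≡ true → τ z ≡ true
      rest τ {p i′ l} z∈ _ _ = contradiction z∈ (p∉phpBlocking i′ l)
      rest τ {b₁ i′} _ ≢ eq with i′ Fin.≟ k
      ... | yes refl = contradiction refl ≢
      ... | no _     = eq
      rest τ {b₂ x y x<y l} _ _ eq with b₂ x y x<y l ≟ᵇ v
      rest τ {b₂ x y x<y l} _ _ () | yes _
      ... | no _ = eq

  -- Redundancy of dominance by exchanging two pigeons.

  pair-symmetric : ∀ {Γ : CNF} → (∀ q → pairClause q ∈ Γ) → ∀ {i k} l → i ≢ k →
                   ∃[ E ] (E ∈ Γ × E ⊆ neg (p i l) ∷ neg (p k l) ∷ [])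
  pair-symmetric pairs {i} {k} l i≢k with Fin.<-cmp i k
  ... | tri< i<k _ _ = _ , pairs (((i , k) , i<k) , l) , id
  ... | tri≈ _ eq _  = contradiction eq i≢k
  ... | tri> _ _ k<i = _ , pairs (((k , i) , k<i) , l) , λ where
    (here refl)         → there (here refl)
    (there (here refl)) → here refl

  swap⊆ : ∀ {x y : Literal} → x ∷ y ∷ [] ⊆ y ∷ x ∷ []
  swap⊆ (here eq)         = there (here eq)
  swap⊆ (there (here eq)) = here eq

  -- The exchange of pigeons J and k.  Its images must avoid the variables of C, so
  -- the variables of J are sent to constants rather than to those of k: J sits in
  -- hole j and nowhere else.
  module Exchange (j : Fin n) (k : Fin m) (J<k : low j Fin.< k) where

    J : Fin m
    J = low j

    C : Clause
    C = dominanceClause j k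

    σ : Substitution
    σ (p i l) with i Fin.≟ J | i Fin.≟ k | l Fin.≟ j
    ... | yes _ | _     | yes _ = const true
    ... | yes _ | _     | no _  = const false
    ... | no _  | yes _ | yes _ = const false
    ... | no _  | yes _ | no _  = lit (pos (p J l))
    ... | no _  | no _  | _     = lit (pos (p i l))
    σ (b₁ i) with i Fin.≟ J | i Fin.≟ k
    ... | yes _ | _     = const false
    ... | no _  | yes _ = lit (pos (b₁ J))
    ... | no _  | no _  = lit (pos (b₁ i))
    σ v@(b₂ _ _ _ _) = lit (pos v)

    J≢k : J ≢ k
    J≢k eq = Fin.<-irrefl eq J<k

    σ-Jj : σ (p J j) ≡ const true
    σ-Jj with J Fin.≟ J | J Fin.≟ k | j Fin.≟ j
    ... | yes _ | _ | yes _ = refl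
    ... | yes _ | _ | no ≢  = contradiction refl ≢
    ... | no ≢  | _ | _     = contradiction refl ≢

    σ-Jl : ∀ {l} → l ≢ j → σ (p J l) ≡ const false
    σ-Jl {l} l≢j with J Fin.≟ J | J Fin.≟ k | l Fin.≟ j
    ... | yes _ | _ | yes eq = contradiction eq l≢j
    ... | yes _ | _ | no _   = refl
    ... | no ≢  | _ | _      = contradiction refl ≢

    σ-kj : σ (p k j) ≡ const false
    σ-kj with k Fin.≟ J | k Fin.≟ k | j Fin.≟ j
    ... | yes eq | _     | _     = contradiction (sym eq) J≢k
    ... | no _   | yes _ | yes _ = refl
    ... | no _   | yes _ | no ≢  = contradiction refl ≢
    ... | no _   | no ≢  | _     = contradiction refl ≢

    σ-kl : ∀ {l} → l ≢ j → σ (p k l) ≡ lit (pos (p J l))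
    σ-kl {l} l≢j with k Fin.≟ J | k Fin.≟ k | l Fin.≟ j
    ... | yes eq | _     | _      = contradiction (sym eq) J≢k
    ... | no _   | yes _ | yes eq = contradiction eq l≢j
    ... | no _   | yes _ | no _   = refl
    ... | no _   | no ≢  | _      = contradiction refl ≢

    σ-p : ∀ {i} l → i ≢ J → i ≢ k → σ (p i l) ≡ lit (pos (p i l))
    σ-p {i} l i≢J i≢k with i Fin.≟ J | i Fin.≟ k | l Fin.≟ j
    ... | yes eq | _      | _ = contradiction eq i≢J
    ... | no _   | yes eq | _ = contradiction eq i≢k
    ... | no _   | no _   | _ = refl

    σ-bJ : σ (b₁ J) ≡ const false
    σ-bJ with J Fin.≟ J | J Fin.≟ k
    ... | yes _ | _ = refl
    ... | no ≢  | _ = contradiction refl ≢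

    σ-bk : σ (b₁ k) ≡ lit (pos (b₁ J))
    σ-bk with k Fin.≟ J | k Fin.≟ k
    ... | yes eq | _     = contradiction (sym eq) J≢k
    ... | no _   | yes _ = refl
    ... | no _   | no ≢  = contradiction refl ≢

    σ-b : ∀ {i} → i ≢ J → i ≢ k → σ (b₁ i) ≡ lit (pos (b₁ i))
    σ-b {i} i≢J i≢k with i Fin.≟ J | i Fin.≟ k
    ... | yes eq | _      = contradiction eq i≢J
    ... | no _   | yes eq = contradiction eq i≢k
    ... | no _   | no _   = refl

    -- Images of pigeon k's hole variables are `p J l` with l ≠ j, which misses `p J j`; pigeons
    -- other than `J` and `k` keep their own variables. Blocking variables map to constants or
    -- blocking variables, and `C` has none.
    fresh : ∀ x {ℓ} → σ x ≡ lit ℓ → ∀ {ℓ′} → ℓ′ ∈ C → var ℓ ≢ var ℓ′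
    fresh (p i l) eq ℓ′∈ with i Fin.≟ J | i Fin.≟ k | l Fin.≟ j
    fresh (p i l) () ℓ′∈ | yes _ | _ | yes _
    fresh (p i l) () ℓ′∈ | yes _ | _ | no _
    fresh (p i l) () ℓ′∈ | no _ | yes _ | yes _
    fresh (p i l) refl (here refl)         | no _ | yes _ | no l≢j = λ { refl → l≢j refl }
    fresh (p i l) refl (there (here refl)) | no _ | yes _ | no l≢j = λ { refl → l≢j refl }
    fresh (p i l) refl (here refl)         | no _ | no i≢k | _ = λ { refl → i≢k refl }
    fresh (p i l) refl (there (here refl)) | no i≢J | no _ | _ = λ { refl → i≢J refl }
    fresh (b₁ i) eq ℓ′∈ with i Fin.≟ J | i Fin.≟ k
    fresh (b₁ i) () ℓ′∈ | yes _ | _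
    fresh (b₁ i) refl (here refl)         | no _ | yes _ = λ ()
    fresh (b₁ i) refl (there (here refl)) | no _ | yes _ = λ ()
    fresh (b₁ i) refl (here refl)         | no _ | no _ = λ ()
    fresh (b₁ i) refl (there (here refl)) | no _ | no _ = λ ()
    fresh (b₂ _ _ _ _) refl (here refl)         = λ ()
    fresh (b₂ _ _ _ _) refl (there (here refl)) = λ ()

    -- Together with `low≢k` this shows that the exchange fixes the variables of every pigeon
    -- settled before stage `j`.
    low≢J : ∀ {j′} → j′ Fin.< j → low j′ ≢ J
    low≢J j′<j eq = Fin.<-irrefl (low-injective eq) j′<j

    low≢k : ∀ {j′} → j′ Fin.< j → low j′ ≢ k
    low≢k j′<j refl = Fin.<-asym (low-mono-< j′<j) J<k

    -- The bounds differ in the dominance count because clauses for other pigeons `k` at the same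
    -- hole `j` may already be present.
    module _ {Γ : CNF} (lo : ∀ {D : Clause} → Line 2 (toℕ j) (toℕ j) (toℕ j) D → D ∈ Γ)
                       (up : ∀ {D : Clause} → D ∈ Γ → Line 2 (suc (toℕ j)) (toℕ j) (toℕ j) D) where

      symmetric : ∀ {i k} l → i ≢ k → ∃[ E ] (E ∈ Γ × E ⊆ neg (p i l) ∷ neg (p k l) ∷ [])
      symmetric = pair-symmetric λ q → lo (pair q (s≤s (s≤s z≤n)))

      -- In hole `j` the image demands ¬ p y j. Under ¬C pigeon `k` sits in hole `j`, so the pair
      -- clause of `y` and `k` is the source. In any other hole `J` is absent after the exchange.
      at-J : ∀ {y} l → y ≢ J → Preserved Γ C σ (neg (p J l) ∷ neg (p y l) ∷ [])
      at-J {y} l y≢J with l Fin.≟ j | y Fin.≟ k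
      ... | no l≢j   | _        = satisfied (here refl) (cong ¬ᵛ_ (σ-Jl l≢j))
      ... | yes refl | yes refl = satisfied (there (here refl)) (cong ¬ᵛ_ σ-kj)
      ... | yes refl | no y≢k with symmetric l y≢k
      ...   | _ , E∈ , E⊆ = subsumed E∈ (sub ∘ E⊆)
        where
        sub : ∀ {ℓ} → ℓ ∈ neg (p y l) ∷ neg (p k l) ∷ [] → _
        sub (here refl)         = inj₂ (_ , there (here refl) , cong ¬ᵛ_ (σ-p l y≢J y≢k))
        sub (there (here refl)) = inj₁ (here refl)

      -- After the exchange `k` is not in hole `j`; in any other hole it takes the role of `J`, so
      -- the source is the pair clause of `y` and `J`.
      at-k : ∀ {y} l → y ≢ k → y ≢ J → Preserved Γ C σ (neg (p k l) ∷ neg (p y l) ∷ [])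
      at-k {y} l y≢k y≢J with l Fin.≟ j
      ... | yes refl = satisfied (here refl) (cong ¬ᵛ_ σ-kj)
      ... | no l≢j with symmetric l y≢J
      ...   | _ , E∈ , E⊆ = subsumed E∈ (sub ∘ E⊆)
        where
        sub : ∀ {ℓ} → ℓ ∈ neg (p y l) ∷ neg (p J l) ∷ [] → _
        sub (here refl)         = inj₂ (_ , there (here refl) , cong ¬ᵛ_ (σ-p l y≢J y≢k))
        sub (there (here refl)) = inj₂ (_ , here refl , cong ¬ᵛ_ (σ-kl l≢j))

      preserved-pair : ∀ q → Preserved Γ C σ (pairClause q)
      preserved-pair q@(((x , y) , x<y) , l)
        with x Fin.≟ J | y Fin.≟ J | x Fin.≟ k | y Fin.≟ k
      ... | yes refl | _        | _        | _        = at-J l λ eq → Fin.<-irrefl (sym eq) x<y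
      ... | no x≢J   | yes refl | _        | _        = Preserved-⊆ swap⊆ (at-J l x≢J)
      ... | no _     | no y≢J   | yes refl | _        = at-k l (λ eq → Fin.<-irrefl (sym eq) x<y) y≢J
      ... | no x≢J   | no _     | no x≢k   | yes refl = Preserved-⊆ swap⊆ (at-k l x≢k x≢J)
      ... | no x≢J   | no y≢J   | no x≢k   | no y≢k   = unaffected (lo (pair q (s≤s (s≤s z≤n)))) λ where
        (here refl)         → cong ¬ᵛ_ (σ-p l x≢J x≢k)
        (there (here refl)) → cong ¬ᵛ_ (σ-p l y≢J y≢k)

      preserved : ∀ {D} → D ∈ C ∷ Γ → Preserved Γ C σ D
      preserved (here refl) = satisfied (there (here refl)) σ-Jj
      preserved (there D∈) with up D∈
      preserved (there D∈) | hole q = Preserved-⊆ (pair⊆hole q) (preserved-pair q)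
      preserved (there D∈) | pair q _ = preserved-pair q
      preserved (there D∈) | unblocked q _ = unaffected D∈ λ { (here refl) → refl }
      preserved (there D∈) | diagonal j′ j′<j = unaffected D∈ λ where
        (here refl) → σ-p j′ (low≢J j′<j) (low≢k j′<j)
      preserved (there D∈) | off j′ offᵇ j′<j = unaffected D∈ λ where
        (here refl) → cong ¬ᵛ_ (σ-b (low≢J j′<j) (low≢k j′<j))
      preserved (there D∈) | off j′ (offᵖ {l} _) j′<j = unaffected D∈ λ where
        (here refl) → cong ¬ᵛ_ (σ-p l (low≢J j′<j) (low≢k j′<j))
      preserved (there D∈) | dominance j′ _ (s≤s j′≤j) with Fin.<-cmp j′ j
      ... | tri≈ _ refl _ = satisfied (there (here refl)) σ-Jj
      ... | tri> _ _ j<j′ = contradiction j′≤j (<⇒≱ j<j′)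
      -- The exchange may alter the negative literal, but the positive one is fixed and is already a
      -- line by itself.
      ... | tri< j′<j _ _ = subsumed (lo (diagonal j′ j′<j)) λ where
        (here refl) → inj₂ (_ , there (here refl) , σ-p j′ (low≢J j′<j) (low≢k j′<j))
      preserved (there D∈) | pigeon i with i Fin.≟ J | i Fin.≟ k
      ... | yes refl | _        = satisfied (p∈pigeon J j) σ-Jj
      ... | no i≢J   | no i≢k   = unaffected D∈ λ ℓ∈ → literal (∈-pigeon⁻ ℓ∈)
        where
        literal : ∀ {ℓ} → PigeonLiteral i ℓ → apply σ ℓ ≡ lit ℓ
        literal (isP l) = σ-p l i≢J i≢k
        literal isB     = σ-b i≢J i≢k
      -- The image of the clause of `k` is the clause of `J` without `p J j`, and `p J j` is a
      -- literal of `C`.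
      ... | no _     | yes refl = subsumed (lo (pigeon J)) λ ℓ∈ → literal (∈-pigeon⁻ ℓ∈)
        where
        literal : ∀ {ℓ} → PigeonLiteral J ℓ →
                  ℓ ∈ C ⊎ ∃[ ℓ′ ] (ℓ′ ∈ pigeonClause m n k × apply σ ℓ′ ≡ lit ℓ)
        literal isB = inj₂ (_ , b∈pigeon k , σ-bk)
        literal (isP l) with l Fin.≟ j
        ... | yes refl = inj₁ (there (here refl))
        ... | no l≢j   = inj₂ (_ , p∈pigeon k l , σ-kl l≢j)

      redundant : IsCostSR Γ C
      redundant = isCostSR nt fresh preserved λ τ _ →
        -- `b₁ k` receives the old value of `b₁ J`, while `b₁ J` becomes false: the cost moves from
        -- `J` to `k`, and whatever `k` paid before is dropped.
        cost-move (τ ∘ˢ σ) τ (b₁ J) (b₁ k) (b₁∈phpBlocking J) (cong (eval τ) σ-bJ)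
          (λ eq → trans (sym (cong (eval τ) σ-bk)) eq) (rest τ)
        where
        nt : ¬ Tautological C
        nt (here (here ()))
        nt (here (there (here refl))) = J≢k refl
        nt (there (here (here refl))) = J≢k refl
        nt (there (here (there (here ()))))

        rest : ∀ τ {z} → z ∈ phpBlocking m n → z ≢ b₁ k → (τ ∘ˢ σ) z ≡ true → τ z ≡ true
        rest τ {p i l} z∈ _ _ = contradiction z∈ (p∉phpBlocking i l)
        rest τ {b₁ i} _ ≢ eq with i Fin.≟ J | i Fin.≟ k
        rest τ {b₁ i} _ ≢ () | yes _ | _
        ... | no _ | yes refl = contradiction refl ≢
        ... | no _ | no _     = eq
        rest τ {b₂ _ _ _ _} _ _ eq = eq

  -- Settling pigeon j in hole j.

  module Settle (j : Fin n) where

    J : Fin m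
    J = low j

    -- ¬ p J j occurs only in hole and pair clauses, next to ¬ p k j for another pigeon `k`. If `k`
    -- comes after `J`, the dominance clause yields ¬ p k j once p J j is falsified; if `k` comes
    -- before, `k` is settled elsewhere and the unit ¬ p k j is a line.
    diagonal-redundant : ∀ {Γ} →
      (∀ {D} → Line 2 (suc (toℕ j)) (toℕ j) (toℕ j) D → D ∈ Γ) →
      (∀ {D} → D ∈ Γ → Line 2 (suc (toℕ j)) (suc (toℕ j)) (toℕ j) D) →
      IsCostSR Γ (pos (p J j) ∷ [])
    diagonal-redundant {Γ} lo up = satisfy (pos (p J j)) exclude λ { refl → p∉phpBlocking J j }
      where
      Excluded : Fin m → Set
      Excluded k = ∃[ E ] (E ∈ Γ × (∀ {ℓ} → ℓ ∈ E → ℓ ≡ pos (p J j) ⊎ ℓ ≡ neg (p k j)))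

      excluded : ∀ k → k ≢ J → Excluded k
      excluded k k≢J with Fin.<-cmp k J
      ... | tri≈ _ eq _  = contradiction eq k≢J
      ... | tri> _ _ J<k = _ , lo (dominance j J<k ≤-refl) , λ where
        (here refl)         → inj₂ refl
        (there (here refl)) → inj₁ refl
      ... | tri< k<J _ _ with split k
      ...   | isHigh i = contradiction k<J (Fin.<-asym (low<high j i))
      ...   | isLow j′ = _ , lo (off j′ (offᵖ λ { refl → k≢J refl }) (low-reflects-< k<J)) , λ where
        (here refl) → inj₂ refl

      in-pair : ∀ {D} k → k ≢ J → neg (p k j) ∈ D →
                ∃[ E ] (E ∈ Γ × (∀ {ℓ} → ℓ ∈ E → ℓ ≡ pos (p J j) ⊎ (ℓ ∈ D × ℓ ≢ neg (p J j))))
      in-pair {D} k k≢J ∈D with excluded k k≢J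
      ... | E , E∈ , h = E , E∈ , sub ∘ h
        where
        sub : ∀ {ℓ} → ℓ ≡ pos (p J j) ⊎ ℓ ≡ neg (p k j) → ℓ ≡ pos (p J j) ⊎ (ℓ ∈ D × ℓ ≢ neg (p J j))
        sub (inj₁ eq)   = inj₁ eq
        sub (inj₂ refl) = inj₂ (∈D , λ { refl → k≢J refl })

      exclude : ∀ {D} → D ∈ Γ → neg (p J j) ∈ D →
                ∃[ E ] (E ∈ Γ × (∀ {ℓ} → ℓ ∈ E → ℓ ≡ pos (p J j) ⊎ (ℓ ∈ D × ℓ ≢ neg (p J j))))
      exclude D∈ ℓ∈ with up D∈
      exclude D∈ ℓ∈ | pigeon i with ∈-pigeon⁻ ℓ∈
      ... | ()
      exclude D∈ (here refl) | hole (((_ , k) , J<k) , _) =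
        in-pair k (λ eq → Fin.<-irrefl (sym eq) J<k) (there (here refl))
      exclude D∈ (there (here refl)) | hole (((i , _) , i<J) , _) =
        in-pair i (λ eq → Fin.<-irrefl eq i<J) (here refl)
      exclude D∈ (there (there (here ()))) | hole _
      exclude D∈ (here refl) | pair (((_ , k) , J<k) , _) _ =
        in-pair k (λ eq → Fin.<-irrefl (sym eq) J<k) (there (here refl))
      exclude D∈ (there (here refl)) | pair (((i , _) , i<J) , _) _ =
        in-pair i (λ eq → Fin.<-irrefl eq i<J) (here refl)
      exclude D∈ (here ()) | unblocked _ _
      exclude D∈ (here refl) | dominance _ J<J _ = contradiction J<J (Fin.<-irrefl refl)
      exclude D∈ (there (here ())) | dominance _ _ _
      exclude D∈ (here ()) | diagonal _ _
      exclude D∈ (here eq) | off j′ (offᵖ _) j′<j with low-injective (p-injective (neg-injective eq))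
        where
        p-injective : ∀ {i i′ l l′} → p {m} {n} i l ≡ p i′ l′ → i ≡ i′
        p-injective refl = refl
      ... | refl = contradiction j′<j (Fin.<-irrefl refl)

    -- The variable `v` occurs positively only in the pigeon clause of `J`, and that clause also
    -- contains `p J j`, by now a line.
    off-redundant : ∀ {Γ v} → Off j v →
      (∀ {D} → Line 2 (suc (toℕ j)) (suc (toℕ j)) (toℕ j) D → D ∈ Γ) →
      (∀ {D} → D ∈ Γ → Line 2 (suc (toℕ j)) (suc (toℕ j)) (suc (toℕ j)) D) →
      IsCostSR Γ (neg v ∷ [])
    off-redundant {Γ} {v} o lo up = satisfy (neg v) other λ ()
      where
      off≢diagonal : ∀ {v} → Off j v → ∀ j′ → p (low j′) j′ ≢ v
      off≢diagonal (offᵖ l≢j) j′ eq = l≢j (trans (sym (hole≡ eq)) (low-injective (pigeon≡ eq)))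
        where
        pigeon≡ : ∀ {i i′ l l′} → p {m} {n} i l ≡ p i′ l′ → i ≡ i′
        pigeon≡ refl = refl
        hole≡ : ∀ {i i′ l l′} → p {m} {n} i l ≡ p i′ l′ → l ≡ l′
        hole≡ refl = refl

      off-pigeon : ∀ {v i} → Off j v → PigeonLiteral i (pos v) → i ≡ J
      off-pigeon offᵇ isB         = refl
      off-pigeon (offᵖ _) (isP _) = refl

      b₂-on : ∀ {v i k l} .{i<k} → Off j v → b₂ i k i<k l ≢ v
      b₂-on () refl

      other : ∀ {D} → D ∈ Γ → pos v ∈ D →
              ∃[ E ] (E ∈ Γ × (∀ {ℓ} → ℓ ∈ E → ℓ ≡ neg v ⊎ (ℓ ∈ D × ℓ ≢ pos v)))
      other D∈ ℓ∈ with up D∈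
      other D∈ ℓ∈ | pigeon i with off-pigeon o (∈-pigeon⁻ ℓ∈)
      ... | refl = _ , lo (diagonal j ≤-refl) , λ where
        (here refl) → inj₂ (p∈pigeon J j , off≢diagonal o j ∘ pos-injective)
      other D∈ (there (there (here eq))) | hole _ = contradiction (sym (pos-injective eq)) (b₂-on o)
      other D∈ (here ()) | pair _ _
      other D∈ (there (here ())) | pair _ _
      other D∈ (here ()) | unblocked _ _
      other D∈ (there (here eq)) | dominance j′ _ _ =
        contradiction (sym (pos-injective eq)) (off≢diagonal o j′)
      other D∈ (here eq) | diagonal j′ _ = contradiction (sym (pos-injective eq)) (off≢diagonal o j′)
      other D∈ (here ()) | off _ _ _

  -- Deriving the lines stage by stage.

  Γ : CNF
  Γ = BPHP m n

  Lines : (t a b c s : ℕ) → Set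
  Lines t a b c = Derivable Γ (Line t a b c) (Line t a b c)

  redundancy : ∀ {Ds D} → IsCostSR (Ds ++ Γ) D → Step Γ Ds D
  redundancy sr = costSR sr (All.tabulate λ {ℓ} _ → occurs (var ℓ))

  with-axioms : ∀ {t a b c Ds D} → (∀ {D} → D ∈ Ds → Line t a b c D) → D ∈ Ds ++ Γ → Line t a b c D
  with-axioms {Ds = Ds} up D∈ = [ up , BPHP⇒Line ]′ (∈-++⁻ Ds D∈)

  -- Resolution takes its premises from the derived lines, so the axioms are first entered as lines.
  axioms : Lines 0 0 0 0 (length Γ + 0)
  axioms = extend {L = λ _ → ⊥} id Γ id BPHP⇒Line is-axiom (λ _ _ → axiom ∘ ∈⇒∈ᶜ) record
    { lines = [] ; derivation = [] ; lower = λ () ; upper = λ () ; size = z≤n }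
    where
    is-axiom : ∀ {D} → Line 0 0 0 0 D → ⊥ ⊎ D ∈ map id Γ
    is-axiom (pigeon i) = inj₂ (∈-map⁺ id (pigeon∈BPHP i))
    is-axiom (hole q)   = inj₂ (∈-map⁺ id (hole∈BPHP q))

  unblock : ∀ {s} → Lines 0 0 0 0 s → Lines 1 0 0 0 (length triples + s)
  unblock = extend f triples (Line-mono z≤n z≤n z≤n z≤n) (λ {q} _ → unblocked q ≤-refl) new
    λ { {x = ((i , k) , i<k) , j} _ up _ → redundancy (Unblock.redundant i k i<k j (with-axioms up)) }
    where
    f : Triple → Clause
    f q = neg (b₂′ q) ∷ []
    new : ∀ {D} → Line 1 0 0 0 D → Line 0 0 0 0 D ⊎ D ∈ map f triples
    new (pigeon i)      = inj₁ (pigeon i)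
    new (hole q)        = inj₁ (hole q)
    new (unblocked q _) = inj₂ (∈-map⁺ f (∈-triples q))
    new (pair _ (s≤s ()))

  pairs : ∀ {s} → Lines 1 0 0 0 s → Lines 2 0 0 0 (length triples + s)
  pairs = extend pairClause triples (Line-mono (s≤s z≤n) z≤n z≤n z≤n) (λ {q} _ → pair q ≤-refl) new
    λ {_} {q} lo _ _ → resolution (b₂′ q) (pairClause q) []
      -- Resolution expects the pivot at the head. Clauses count as sets, so the hole clause is
      -- presented with its blocking literal rotated to the front.
      (lose (lo (hole q)) (mk⇔ front back))
      (∈⇒∈ᶜ (lo (unblocked q ≤-refl))) (mk⇔ id id)
    where
    front : ∀ {x y z ℓ : Literal} → ℓ ∈ z ∷ x ∷ y ∷ [] → ℓ ∈ x ∷ y ∷ z ∷ []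
    front (here eq)                 = there (there (here eq))
    front (there (here eq))         = here eq
    front (there (there (here eq))) = there (here eq)
    back : ∀ {x y z ℓ : Literal} → ℓ ∈ x ∷ y ∷ z ∷ [] → ℓ ∈ z ∷ x ∷ y ∷ []
    back (here eq)                 = there (here eq)
    back (there (here eq))         = there (there (here eq))
    back (there (there (here eq))) = here eq
    new : ∀ {D} → Line 2 0 0 0 D → Line 1 0 0 0 D ⊎ D ∈ map pairClause triples
    new (pigeon i)      = inj₁ (pigeon i)
    new (hole q)        = inj₁ (hole q)
    new (unblocked q _) = inj₁ (unblocked q ≤-refl)
    new (pair q _)      = inj₂ (∈-map⁺ pairClause (∈-triples q))

  <suc-cases : ∀ {j j′ : Fin n} → toℕ j′ < suc (toℕ j) → toℕ j′ < toℕ j ⊎ j ≡ j′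
  <suc-cases lt = map₂ (sym ∘ Fin.toℕ-injective) (m<1+n⇒m<n∨m≡n lt)

  module Stage (j : Fin n) where

    h : ℕ
    h = toℕ j

    later : List (Fin m)
    later = filter (low j Fin.<?_) (allFin m)

    dominances : ∀ {s} → Lines 2 h h h s → Lines 2 (suc h) h h (length later + s)
    dominances = extend (dominanceClause j) later (Line-mono ≤-refl (n≤1+n h) ≤-refl ≤-refl)
      (λ k∈ → dominance j (proj₂ (∈-filter⁻ (low j Fin.<?_) {xs = allFin m} k∈)) ≤-refl) new
      λ {_} {k} lo up k∈ → redundancy (Exchange.redundant j k
        (proj₂ (∈-filter⁻ (low j Fin.<?_) {xs = allFin m} k∈)) (∈-++⁺ˡ ∘ lo) (with-axioms up))
      where
      new : ∀ {D} → Line 2 (suc h) h h D → Line 2 h h h D ⊎ D ∈ map (dominanceClause j) later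
      new (pigeon i)      = inj₁ (pigeon i)
      new (hole q)        = inj₁ (hole q)
      new (unblocked q x) = inj₁ (unblocked q x)
      new (pair q x)      = inj₁ (pair q x)
      new (diagonal j′ x) = inj₁ (diagonal j′ x)
      new (off j′ o x)    = inj₁ (off j′ o x)
      new (dominance j′ {k} lt x) with <suc-cases x
      ... | inj₁ x′   = inj₁ (dominance j′ lt x′)
      ... | inj₂ refl = inj₂ (∈-map⁺ (dominanceClause j) (∈-filter⁺ (low j Fin.<?_) (∈-allFin k) lt))

    diagonals : ∀ {s} → Lines 2 (suc h) h h s → Lines 2 (suc h) (suc h) h (1 + s)
    diagonals = extend f (j ∷ []) (Line-mono ≤-refl ≤-refl (n≤1+n h) ≤-refl)
      (λ { (here refl) → diagonal j ≤-refl }) new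
      λ { lo up (here refl) → redundancy (Settle.diagonal-redundant j (∈-++⁺ˡ ∘ lo) (with-axioms up)) }
      where
      f : Fin n → Clause
      f j = pos (p (low j) j) ∷ []
      new : ∀ {D} → Line 2 (suc h) (suc h) h D → Line 2 (suc h) h h D ⊎ D ∈ map f (j ∷ [])
      new (pigeon i)          = inj₁ (pigeon i)
      new (hole q)            = inj₁ (hole q)
      new (unblocked q x)     = inj₁ (unblocked q x)
      new (pair q x)          = inj₁ (pair q x)
      new (dominance j′ lt x) = inj₁ (dominance j′ lt x)
      new (off j′ o x)        = inj₁ (off j′ o x)
      new (diagonal j′ x) with <suc-cases x
      ... | inj₁ x′   = inj₁ (diagonal j′ x′)
      ... | inj₂ refl = inj₂ (here refl)

    otherHoles : List (Fin n)
    otherHoles = filter (λ l → ¬? (l Fin.≟ j)) (allFin n)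

    offs : List (PHPVar m n)
    offs = b₁ (low j) ∷ map (p (low j)) otherHoles

    Off⇒∈ : ∀ {v} → Off j v → v ∈ offs
    Off⇒∈ offᵇ           = here refl
    Off⇒∈ (offᵖ {l} l≢j) = there (∈-map⁺ (p (low j))
      (∈-filter⁺ (λ l → ¬? (l Fin.≟ j)) (∈-allFin l) l≢j))

    ∈⇒Off : ∀ {v} → v ∈ offs → Off j v
    ∈⇒Off (here refl) = offᵇ
    ∈⇒Off (there v∈) with ∈-map⁻ (p (low j)) v∈
    ... | l , l∈ , refl = offᵖ (proj₂ (∈-filter⁻ (λ l → ¬? (l Fin.≟ j)) {xs = allFin n} l∈))

    clear : ∀ {s} → Lines 2 (suc h) (suc h) h s → Lines 2 (suc h) (suc h) (suc h) (length offs + s)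
    clear = extend f offs (Line-mono ≤-refl ≤-refl ≤-refl (n≤1+n h))
      (λ v∈ → off j (∈⇒Off v∈) ≤-refl) new
      λ lo up v∈ → redundancy (Settle.off-redundant j (∈⇒Off v∈) (∈-++⁺ˡ ∘ lo) (with-axioms up))
      where
      f : PHPVar m n → Clause
      f v = neg v ∷ []
      new : ∀ {D} → Line 2 (suc h) (suc h) (suc h) D → Line 2 (suc h) (suc h) h D ⊎ D ∈ map f offs
      new (pigeon i)          = inj₁ (pigeon i)
      new (hole q)            = inj₁ (hole q)
      new (unblocked q x)     = inj₁ (unblocked q x)
      new (pair q x)          = inj₁ (pair q x)
      new (dominance j′ lt x) = inj₁ (dominance j′ lt x)
      new (diagonal j′ x)     = inj₁ (diagonal j′ x)
      new (off j′ o x) with <suc-cases x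
      ... | inj₁ x′   = inj₁ (off j′ o x′)
      ... | inj₂ refl = inj₂ (∈-map⁺ f (Off⇒∈ o))

    -- A stage adds at most m dominance clauses, one diagonal unit and at most n + 1 negative units.
    stage : ∀ {s} → Lines 2 h h h s → Lines 2 (suc h) (suc h) (suc h) (m + n + 2 + s)
    stage {s} l = weaken-size (bound _ _ (length-filter-allFin (low j Fin.<?_)) length-offs)
                          (clear (diagonals (dominances l)))
      where
      length-filter-allFin : ∀ {k} {P : Fin k → Set} (P? : ∀ i → Dec (P i)) → length (filter P? (allFin k)) ≤ k
      length-filter-allFin {k} P? = ≤-trans (length-filter P? (allFin k)) (≤-reflexive (length-allFin _))

      length-offs : length offs ≤ suc n
      length-offs = s≤s (≤-trans (≤-reflexive (length-map (p (low j)) otherHoles)) (length-filter-allFin _))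

      bound : ∀ x y → x ≤ m → y ≤ suc n → y + (1 + (x + s)) ≤ m + n + 2 + s
      bound x y x≤ y≤ = ≤-trans (+-mono-≤ y≤ (+-monoʳ-≤ 1 (+-monoˡ-≤ s x≤))) (≤-reflexive (rearrange m n s))
        where
        rearrange : ∀ m n s → suc n + (1 + (m + s)) ≡ m + n + 2 + s
        rearrange = solve-∀

  stages : ∀ {s} h → h ≤ n → Lines 2 0 0 0 s → Lines 2 h h h (h * (m + n + 2) + s)
  stages zero    _   l = l
  stages {s} (suc h) h<n l = weaken-size (≤-reflexive (sym (+-assoc (m + n + 2) (h * (m + n + 2)) s)))
    -- The stage is indexed by the `toℕ` of a hole, which equals `h` only propositionally; `at-hole`
    -- transports along that equation.
    (at-hole (Fin.toℕ-fromℕ< h<n) (Stage.stage (fromℕ< h<n)) (stages h (<⇒≤ h<n) l))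
    where
    at-hole : ∀ {h h′ s s′} → h′ ≡ h → (Lines 2 h′ h′ h′ s → Lines 2 (suc h′) (suc h′) (suc h′) s′) →
              Lines 2 h h h s → Lines 2 (suc h) (suc h) (suc h) s′
    at-hole refl f = f

  -- Resolving the clauses of the surplus pigeons to units.

  Expelled : Clause → Set
  Expelled D = Line 2 n n n D ⊎ ∃[ i ] ∃[ j ] D ≡ neg (p (high i) j) ∷ []

  -- Hole `j` is occupied by `low j`, so the pair clause of `low j` and `high i` resolves with the
  -- diagonal unit. From here on all steps are resolutions, which look only at their two premises;
  -- hence the trivial upper bound.
  expel : ∀ {s} → Lines 2 n n n s → Derivable Γ Expelled (λ _ → ⊤) (d * n + s)
  expel {s} = weaken-size (+-monoˡ-≤ s (≤-reflexive (trans (length-cartesianProduct (allFin d) (allFin n))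
                (cong₂ _*_ (length-allFin d) (length-allFin n))))) ∘
    extend f (cartesianProduct (allFin d) (allFin n)) _ _ new
      λ { {x = i , j} lo _ _ → resolution (p (low j) j) [] (f (i , j))
            (∈⇒∈ᶜ (lo (diagonal j (Fin.toℕ<n j))))
            (∈⇒∈ᶜ (lo (pair (((low j , high i) , low<high j i) , j) ≤-refl))) (mk⇔ id id) }
    where
    f : Fin d × Fin n → Clause
    f (i , j) = neg (p (high i) j) ∷ []
    new : ∀ {D} → Expelled D → Line 2 n n n D ⊎ D ∈ map f (cartesianProduct (allFin d) (allFin n))
    new (inj₁ l) = inj₁ l
    new (inj₂ (i , j , refl)) = inj₂ (∈-map⁺ f (∈-cartesianProduct⁺ (∈-allFin i) (∈-allFin j)))

  remaining : List (Fin n) → Fin d → Clause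
  remaining js i = map (λ j → pos (p (high i) j)) js ++ pos (b₁ (high i)) ∷ []

  Reduced : List (Fin n) → Clause → Set
  Reduced js D = Expelled D ⊎ ∃[ i ] D ≡ remaining js i

  -- Holes are removed one at a time: each round resolves the clauses of all d surplus pigeons with
  -- the units from `expel`, at a cost of d lines.
  reduce : ∀ {s} js → Derivable Γ (Reduced js) (λ _ → ⊤) s →
           Derivable Γ (Reduced []) (λ _ → ⊤) (length js * d + s)
  reduce []       l = l
  reduce {s} (j ∷ js) l = weaken-size (≤-reflexive (trans (sym (+-assoc (length js * d) d s))
                                                      (cong (_+ s) (+-comm (length js * d) d))))
    (reduce js (weaken-size (+-monoˡ-≤ s (≤-reflexive (length-allFin _)))
      (extend (remaining js) (allFin d) _ _ new
        (λ {Ds} {i} lo _ _ → resolution (p (high i) j) (remaining js i) []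
          (∈⇒∈ᶜ (lo (inj₂ (i , refl)))) (∈⇒∈ᶜ (lo (inj₁ (inj₂ (i , j , refl)))))
          (subst (remaining js i ≈_) (sym (++-identityʳ _)) (mk⇔ id id))) l)))
    where
    new : ∀ {D} → Reduced js D → Reduced (j ∷ js) D ⊎ D ∈ map (remaining js) (allFin d)
    new (inj₁ e)          = inj₁ (inj₁ e)
    new (inj₂ (i , refl)) = inj₂ (∈-map⁺ (remaining js) (∈-allFin i))

  -- `remaining (allFin n) i` computes to the pigeon clause of `high i`, so the same lines serve.
  withPigeons : ∀ {s} → Derivable Γ Expelled (λ _ → ⊤) s → Derivable Γ (Reduced (allFin n)) (λ _ → ⊤) s
  withPigeons l = record
    { Derivable l hiding (lower)
    ; lower = λ { (inj₁ e) → Derivable.lower l e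
                ; (inj₂ (i , refl)) → Derivable.lower l (inj₁ (pigeon (high i))) } }

  costProof : ∀ {s} (l : Derivable Γ (Reduced []) (λ _ → ⊤) s) → IsCostProof Γ d (Derivable.lines l)
  costProof l = record
    { derivation = derivation
    ; ones = map (b₁ ∘ high) (allFin d)
    ; unique = Unique.map⁺ (Fin.↑ʳ-injective n _ _ ∘ b₁-injective) (Unique.allFin⁺ d)
    ; count = trans (length-map (b₁ ∘ high) (allFin d)) (length-allFin _)
    ; areBlock = ones⊆
    ; positive = λ _ b∈ → ∈⇒∈ᶜ (positive b∈)
    ; negative = λ _ b∈ b∉ → ∈⇒∈ᶜ (negative b∈ b∉) }
    where
    open Derivable l
    ones⊆ : map (b₁ ∘ high) (allFin d) ⊆ phpBlocking m n
    ones⊆ v∈ with ∈-map⁻ (b₁ ∘ high) v∈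
    ... | i , _ , refl = b₁∈phpBlocking (high i)

    positive : ∀ {v} → v ∈ map (b₁ ∘ high) (allFin d) → pos v ∷ [] ∈ lines
    positive v∈ with ∈-map⁻ (b₁ ∘ high) v∈
    -- With no hole left, `remaining [] i` is the unit clause of `b₁ (high i)`.
    ... | i , _ , refl = lower (inj₂ (i , refl))

    negative : ∀ {v} → v ∈ phpBlocking m n → v ∉ map (b₁ ∘ high) (allFin d) → neg v ∷ [] ∈ lines
    negative v∈ v∉ with ∈-++⁻ (map b₁ (allFin m)) v∈
    ... | inj₂ v∈₂ with ∈-map⁻ b₂′ v∈₂
    ...   | q , _ , refl = lower (inj₁ (inj₁ (unblocked q (s≤s z≤n))))
    negative v∈ v∉ | inj₁ v∈₁ with ∈-map⁻ b₁ v∈₁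
    ...   | k , _ , refl with split k
    ...     | isLow j  = lower (inj₁ (inj₁ (off j offᵇ (Fin.toℕ<n j))))
    ...     | isHigh i = contradiction (∈-map⁺ (b₁ ∘ high) (∈-allFin i)) v∉

  -- Size of the derivation.

  length-triples : length triples ≤ m * m * n
  length-triples = ≤-trans (≤-reflexive (length-cartesianProduct (orderedPairs m) (allFin n)))
    (*-mono-≤ (≤-trans (length-mapMaybe orderedPair (cartesianProduct (allFin m) (allFin m)))
                (≤-reflexive (trans (length-cartesianProduct (allFin m) (allFin m))
                  (cong₂ _*_ (length-allFin m) (length-allFin m)))))
              (≤-reflexive (length-allFin n)))

  length-Γ : length Γ ≡ m + length triples
  length-Γ = trans (length-++ (map (pigeonClause m n) (allFin m)))
    (cong₂ _+_ (trans (length-map (pigeonClause m n) (allFin m)) (length-allFin _))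
               (length-map (holeClause m n) triples))

  complete : Derivable Γ (Reduced []) (λ _ → ⊤) (⟦ polynomial ⟧ m n)
  complete = weaken-size total
    (reduce (allFin n) (withPigeons (expel (stages n ≤-refl (pairs (unblock axioms))))))
    where
    d≤m : d ≤ m
    d≤m = m≤n+m d n

    length-Γ-≤ : length Γ + 0 ≤ m + m * m * n + 0
    length-Γ-≤ = +-monoˡ-≤ 0 (≤-trans (≤-reflexive length-Γ) (+-monoʳ-≤ m length-triples))

    -- The right-hand side is `⟦ polynomial ⟧ m n` with its sum and powers unfolded, so that the
    -- ring solver can treat it.
    rearrange : ∀ m n → n * m + (m * n + (n * (m + n + 2) + (m * m * n + (m * m * n + (m + m * m * n + 0)))))
                ≡ 1 * (m * 1) * 1 + (3 * (m * (m * 1)) * (n * 1) + (3 * (m * 1) * (n * 1)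
                  + (1 * 1 * (n * (n * 1)) + (2 * 1 * (n * 1) + 0))))
    rearrange = solve-∀

    total : length (allFin n) * d + (d * n + (n * (m + n + 2) +
              (length triples + (length triples + (length Γ + 0))))) ≤ ⟦ polynomial ⟧ m n
    total = ≤-trans
      (+-mono-≤ (*-mono-≤ (≤-reflexive (length-allFin n)) d≤m)
        (+-mono-≤ (*-monoˡ-≤ n d≤m)
          (+-monoʳ-≤ (n * (m + n + 2)) (+-mono-≤ length-triples (+-mono-≤ length-triples length-Γ-≤)))))
      (≤-reflexive (rearrange m n))

theorem6p3 : ∃[ q ] (∀ (m n : ℕ) → n < m → 1 ≤ n →
    ∃[ Ds ] (CostSR.IsCostProof (phpVariables m n) (BPHP m n) (m ∸ n) Ds
    × length Ds ≤ ⟦ q ⟧ m n))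
theorem6p3 = polynomial , proof
  where
  proof : ∀ (m n : ℕ) → n < m → 1 ≤ n →
          ∃[ Ds ] (CostSR.IsCostProof (phpVariables m n) (BPHP m n) (m ∸ n) Ds × length Ds ≤ ⟦ polynomial ⟧ m n)
  proof m n n<m _ with m≤n⇒∃[o]m+o≡n (<⇒≤ n<m)
  ... | d , refl rewrite m+n∸m≡n n d = lines , costProof complete , size
    where
    open BlockedPigeonhole n d
    open Calculus.Derivable complete
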